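{- Let $\lambda$ be an odd partition of $n$. If $n$ is even, then there exists a unique odd partition $\mu\in\lambda^+$. If $n$ is odd and $v=v_2(n+1)$, then $$|\lambda^+\cap\Lambda^{\mathrm{odd}}_{n+1}|=\begin{cases}2,&\text{if }\mathrm{core}_{2^v}(\lambda)\text{ is a hook},\\0,&\text{otherwise.}\end{cases}$$ In particular, the subgraph of Young's graph induced on $\Lambda^{\mathrm{odd}}$ is an (incomplete) binary tree.
   Context: For a partition $\lambda$, $f_\lambda$ is the number of standard Young tableaux of shape $\lambda$; $\lambda$ is odd if $f_\lambda$ is odd. $\Lambda^{\mathrm{odd}}$ is the set of odd partitions and $\Lambda^{\mathrm{odd}}_m$ those of size $m$. Young's graph is the Hasse diagram of Young's lattice (partitions ordered by containment of Young diagrams); $\lambda^+$ is the set of partitions covering $\lambda$ (obtained by adding one cell). $v_2$ is the $2$-adic valuation. For $p>1$, $\mathrm{core}_p(\lambda)$ is the $p$-core of $\lambda$, obtained by repeatedly removing rim hooks (border strips) of length $p$ until none remain. A hook is a partition of the form $(a+1,1^b)$ with $a,b\ge 0$. -}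

module Defs where

open import Data.Nat using (ℕ; zero; suc; _+_; _∸_; _≤_; _<_; _≥_; _≤ᵇ_; _≡ᵇ_; _%_)
open import Data.Nat.ListAction using (sum)
open import Data.List using (List; []; _∷_; map; upTo; length; null; filterᵇ; replicate)
open import Data.List.Relation.Unary.All using (All)
open import Data.List.Relation.Unary.Linked using (Linked)
open import Data.Bool using (Bool; true; false; if_then_else_; _∧_; not)
open import Data.Product using (_×_; _,_; ∃-syntax)
open import Data.Sum using (_⊎_)
open import Relation.Binary.PropositionalEquality using (_≡_; _≢_)
open import Relation.Nullary using (¬_)

IsPartition : List ℕ → Set
IsPartition la = Linked _≥_ la × All (λ k → 0 < k) la

size : List ℕ → ℕ
size = sum

part : List ℕ → ℕ → ℕ
part []       _       = 0
part (x ∷ xs) zero    = x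
part (x ∷ xs) (suc i) = part xs i

Contained : List ℕ → List ℕ → Set
Contained la mu = ∀ i → part la i ≤ part mu i

Covers : List ℕ → List ℕ → Set
Covers la mu = IsPartition mu × Contained la mu × size mu ≡ suc (size la)

-- f_λ = number of standard Young tableaux of shape λ, computed as the number
-- of saturated chains ∅ = λ⁰ ⋖ λ¹ ⋖ … ⋖ λⁿ = λ (the cell labelled k in the
-- tableau is the cell added at step k): remove a corner, recurse.

decAt : ℕ → List ℕ → List ℕ
decAt _       []       = []
decAt zero    (x ∷ xs) = (x ∸ 1) ∷ xs
decAt (suc i) (x ∷ xs) = x ∷ decAt i xs

weaklyDecᵇ : List ℕ → Bool
weaklyDecᵇ []           = true
weaklyDecᵇ (x ∷ [])     = true
weaklyDecᵇ (x ∷ y ∷ ys) = (y ≤ᵇ x) ∧ weaklyDecᵇ (y ∷ ys)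

dropZeros : List ℕ → List ℕ
dropZeros = filterᵇ (λ k → not (k ≡ᵇ 0))

chains : ℕ → List ℕ → ℕ
chains zero    la = if null la then 1 else 0
chains (suc k) la = sum (map step (upTo (length la)))
  where
  step : ℕ → ℕ
  step i = if weaklyDecᵇ (decAt i la) then chains k (dropZeros (decAt i la)) else 0

numSYT : List ℕ → ℕ
numSYT la = chains (size la) la

IsOdd : List ℕ → Set
IsOdd la = numSYT la % 2 ≡ 1

Cell : Set
Cell = ℕ × ℕ

InSkew : List ℕ → List ℕ → Cell → Set
InSkew la nu (i , j) = part nu i ≤ j × j < part la i

data Adj : Cell → Cell → Set where
  right : ∀ {i j} → Adj (i , j) (i , suc j)
  left  : ∀ {i j} → Adj (i , suc j) (i , j)
  down  : ∀ {i j} → Adj (i , j) (suc i , j)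
  up    : ∀ {i j} → Adj (suc i , j) (i , j)

data Path (S : Cell → Set) : Cell → Cell → Set where
  here : ∀ {c} → S c → Path S c c
  step : ∀ {c d e} → S c → Adj c d → Path S d e → Path S c e

IsRimHookRemoval : ℕ → List ℕ → List ℕ → Set
IsRimHookRemoval p la nu =
  IsPartition nu × Contained nu la × size la ≡ size nu + p
  × (∀ c d → InSkew la nu c → InSkew la nu d → Path (InSkew la nu) c d)
  × (∀ i j → ¬ (InSkew la nu (i , j) × InSkew la nu (suc i , j)
               × InSkew la nu (i , suc j) × InSkew la nu (suc i , suc j)))

data RimHookChain (p : ℕ) : List ℕ → List ℕ → Set where
  done : ∀ {la} → RimHookChain p la la
  rem  : ∀ {la nu ka} → IsRimHookRemoval p la nu → RimHookChain p nu ka → RimHookChain p la ka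

IsCore : ℕ → List ℕ → List ℕ → Set
IsCore p la ka = RimHookChain p la ka × (∀ nu → ¬ IsRimHookRemoval p ka nu)

IsHook : List ℕ → Set
IsHook la = ∃[ a ] ∃[ b ] (la ≡ suc a ∷ replicate b 1)

TwoOddCovers : List ℕ → Set
TwoOddCovers la =
  ∃[ m1 ] ∃[ m2 ] (m1 ≢ m2 × (Covers la m1 × IsOdd m1) × (Covers la m2 × IsOdd m2)
    × (∀ mu → Covers la mu → IsOdd mu → mu ≡ m1 ⊎ mu ≡ m2))

{-# OPTIONS --safe #-}
module Submission where

-- A partition is encoded by its bead set, so that removing a rim p-hook is moving a bead from p + q to a free q.
-- Mod 2 the sum of the lowerings of the single beads squares to the sum of their squares, so f_λ is congruent to the
-- sum of f_ν over the removals of a 2^k-hook; when 2^k ≤ |λ| < 2^(k+1) there is at most one, and λ is odd iff it exists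
-- and leaves an odd partition (Macdonald).  If also |λ| + 1 < 2^(k+1), removing the 2^k-hook matches the odd covers
-- of λ with those of the smaller partition: the positions of the moved beads correspond under the interchange of two
-- adjacent positions with their translates by 2^k.  This leads down to |λ| = 0, where there is one cover, and to
-- |λ| + 1 = 2^v, where λ is its own 2^v-core and the odd covers are the hooks among the covers.  The same
-- correspondence, read from the covering partition, reduces uniqueness of the odd predecessor to hooks of size 2^k,
-- which have at most two predecessors but an odd number of odd ones.

open import Defs
open import Data.Bool using (Bool; true; false; _xor_; not; T; if_then_else_)
open import Data.Bool.Properties using (xor-same; xor-identityʳ; xor-assoc; xor-comm; ¬-not; not-involutive; ∧-conicalˡ; ∧-conicalʳ; not-distribˡ-xor)
open import Data.Empty using (⊥; ⊥-elim)
open import Data.List using (List; []; _∷_; length; downFrom; map; upTo; applyUpTo; replicate; _++_)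
open import Data.List.Membership.Propositional using (_∈_; _∉_)
open import Data.List.Membership.Propositional.Properties using (∈-∃++; ∈-downFrom⁺; ∈-downFrom⁻)
open import Data.List.Properties using (∷-injective; map-upTo; length-replicate)
open import Data.List.Relation.Binary.Permutation.Propositional using (_↭_; refl; prep; swap; trans; ↭-sym; ↭-reflexive; ↭⇒↭ₛ)
open import Data.List.Relation.Binary.Permutation.Propositional.Properties using (∈-resp-↭; drop-∷; shift; ↭-length; ↭-empty-inv; ¬x∷xs↭[]; All-resp-↭)
import Data.List.Relation.Binary.Permutation.Setoid.Properties as PermSetoid
open import Data.List.Relation.Unary.All as All using (All; []; _∷_)
open import Data.List.Relation.Unary.All.Properties using (All¬⇒¬Any; ¬Any⇒All¬)
open import Data.List.Relation.Unary.AllPairs as AllPairs using (AllPairs; []; _∷_)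
open import Data.List.Relation.Unary.Any using (here; there)
open import Data.List.Relation.Unary.Linked as Linked using (Linked; []; [-]; _∷_)
open import Data.List.Relation.Unary.Unique.Propositional using (Unique)
open import Data.Nat using (ℕ; zero; suc; _+_; _∸_; _^_; _%_; _≤_; _<_; _≥_; _>_; z≤n; s≤s; z<s; s≤s⁻¹; _≤ᵇ_; >-nonZero)
open import Data.Nat.Divisibility using (_∣_; divides; ∣-refl; ∣-trans; ∣⇒≤; ∣1⇒≡1; m∣m*n; ∣m+n∣m⇒∣n; ∣m∣n⇒∣m+n; m%n≡0⇒n∣m)
open import Data.Nat.Induction using (<-rec)
open import Data.Nat.ListAction using (sum)
open import Data.Nat.ListAction.Properties using (sum-↭)
open import Data.Nat.Properties
open import Data.List.Membership.DecPropositional _≟_ using (_∈?_)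
open import Data.List.Relation.Unary.Unique.DecPropositional _≟_ using (unique?)
open import Data.Nat.Tactic.RingSolver using (solve-∀)
open import Data.Product using (_×_; _,_; ∃-syntax; proj₁; proj₂)
open import Data.Sum as Sum using (_⊎_; inj₁; inj₂)
open import Data.Unit using (tt)
open import Function using (_∘_)
open import Relation.Binary.Definitions using (tri<; tri≈; tri>)
open import Relation.Binary.PropositionalEquality using (_≡_; _≢_; refl; sym; cong; cong₂; subst; subst₂; setoid; module ≡-Reasoning) renaming (trans to ≡-trans)
open import Relation.Nullary using (¬_; yes; no; does)
open import Relation.Nullary.Decidable using (dec-true; dec-false)

-- Lowerings of beads commute only when none is forbidden, yet a bead must not enter an occupied
-- position. For this reason `F` is defined on arbitrary lists of positions, repetitions included,
-- and shown to vanish on those with a repetition. Illegal moves then drop out of every sum by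
-- themselves, and squaring is plain algebra in characteristic 2. The interchange of positions is
-- forced by a collision. Say that the leading hook of λ moves a bead from p + s to s. A cover of λ
-- may raise a bead from s - 1 to s and so occupy the landing position. Its own leading hook then
-- takes p + s - 1 to s - 1, and seen from the smaller partition it is p + s - 1 that has been
-- raised. Raising the moved bead itself becomes raising s; every other raising keeps its position.

-- Lists of positions up to permutation

extract : ∀ {x : ℕ} {L} → x ∈ L → ∃[ R ] (L ↭ x ∷ R)
extract x∈L with xs , ys , refl ← ∈-∃++ x∈L = xs ++ ys , shift _ xs ys

∷-split : ∀ {x y : ℕ} {R S} → x ∷ R ↭ y ∷ S → x ≢ y → ∃[ Q ] (R ↭ y ∷ Q × S ↭ x ∷ Q)
∷-split {x} {y} {R} {S} p x≢y with ∈-resp-↭ (↭-sym p) (here refl)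
... | here y≡x = ⊥-elim (x≢y (sym y≡x))
... | there y∈R with Q , R↭ ← extract y∈R =
  Q , R↭ , drop-∷ (trans (↭-sym p) (trans (prep x R↭) (swap x y refl)))

Unique-resp-↭ : ∀ {xs ys : List ℕ} → xs ↭ ys → Unique xs → Unique ys
Unique-resp-↭ p = PermSetoid.Unique-resp-↭ (setoid ℕ) (↭⇒↭ₛ p)

unique-∉ : ∀ {x : ℕ} {R} → Unique (x ∷ R) → x ∉ R
unique-∉ (x≢ ∷ _) = All¬⇒¬Any x≢

unique-tail : ∀ {x : ℕ} {R} → Unique (x ∷ R) → Unique R
unique-tail (_ ∷ u) = u

unique-cons : ∀ {x : ℕ} {R} → x ∉ R → Unique R → Unique (x ∷ R)
unique-cons x∉ u = ¬Any⇒All¬ _ x∉ ∷ u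

∉-cons : ∀ {x y : ℕ} {R} → x ≢ y → x ∉ R → x ∉ y ∷ R
∉-cons x≢y x∉R (here e)  = x≢y e
∉-cons x≢y x∉R (there i) = x∉R i

-- Sums of bead lowerings modulo 2

lower : ℕ → (ℕ → Bool) → ℕ → Bool
lower zero    f x       = f x
lower (suc p) f zero    = false
lower (suc p) f (suc x) = lower p f x

lower-+ : ∀ p f q → lower p f (p + q) ≡ f q
lower-+ zero    f q = refl
lower-+ (suc p) f q = lower-+ p f q

lower-true : ∀ p f x → lower p f x ≡ true → ∃[ q ] (x ≡ p + q × f q ≡ true)
lower-true zero    f x       e = x , refl , e
lower-true (suc p) f (suc x) e with q , x≡ , fq ← lower-true p f x e = q , cong suc x≡ , fq

lower-cong : ∀ p {f g} → (∀ z → f z ≡ g z) → ∀ x → lower p f x ≡ lower p g x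
lower-cong zero    f≗g x       = f≗g x
lower-cong (suc p) f≗g zero    = refl
lower-cong (suc p) f≗g (suc x) = lower-cong p f≗g x

lower-xor : ∀ p f g x → lower p (λ z → f z xor g z) x ≡ lower p f x xor lower p g x
lower-xor zero    f g x       = refl
lower-xor (suc p) f g zero    = refl
lower-xor (suc p) f g (suc x) = lower-xor p f g x

lower-lower : ∀ p q f x → lower p (lower q f) x ≡ lower (p + q) f x
lower-lower zero    q f x       = refl
lower-lower (suc p) q f zero    = refl
lower-lower (suc p) q f (suc x) = lower-lower p q f x

-- Mod 2, and on bead sets of partitions, D p F sums F over all removals of a rim p-hook.
D : ℕ → (List ℕ → Bool) → List ℕ → Bool
D p F []       = false
D p F (x ∷ xs) = lower p (λ z → F (z ∷ xs)) x xor D p (λ ys → F (x ∷ ys)) xs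

D-cong : ∀ p {F G} → (∀ B → F B ≡ G B) → ∀ B → D p F B ≡ D p G B
D-cong p F≗G []       = refl
D-cong p F≗G (x ∷ xs) =
  cong₂ _xor_ (lower-cong p (λ z → F≗G (z ∷ xs)) x) (D-cong p (λ ys → F≗G (x ∷ ys)) xs)

xor-interchange : ∀ a b c d → (a xor b) xor (c xor d) ≡ (a xor c) xor (b xor d)
xor-interchange false b     c d = ≡-trans (sym (xor-assoc b c d)) (≡-trans (cong (_xor d) (xor-comm b c)) (xor-assoc c b d))
xor-interchange true  false c d = ≡-trans (sym (xor-assoc true c d)) refl
xor-interchange true  true  false d = sym (≡-trans (sym (xor-assoc true true d)) refl)
xor-interchange true  true  true  d = refl

D-xor : ∀ p F G B → D p (λ C → F C xor G C) B ≡ D p F B xor D p G B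
D-xor p F G []       = refl
D-xor p F G (x ∷ xs) = ≡-trans
  (cong₂ _xor_ (lower-xor p (λ z → F (z ∷ xs)) (λ z → G (z ∷ xs)) x) (D-xor p (λ ys → F (x ∷ ys)) (λ ys → G (x ∷ ys)) xs))
  (xor-interchange (lower p (λ z → F (z ∷ xs)) x) _ _ _)

D-false : ∀ p B → D p (λ _ → false) B ≡ false
D-false p []       = refl
D-false p (x ∷ xs) = cong₂ _xor_ (lower-false p x) (D-false p xs)
  where
  lower-false : ∀ p x → lower p (λ _ → false) x ≡ false
  lower-false zero    x       = refl
  lower-false (suc p) zero    = refl
  lower-false (suc p) (suc x) = lower-false p x

D-lower-comm : ∀ p q (F : ℕ → List ℕ → Bool) x B →
  D p (λ C → lower q (λ z → F z C) x) B ≡ lower q (λ z → D p (F z) B) x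
D-lower-comm p zero    F x       B = refl
D-lower-comm p (suc q) F zero    B = D-false p B
D-lower-comm p (suc q) F (suc x) B = D-lower-comm p q F x B

-- Lowerings of different beads commute, so the mixed terms of the square cancel mod 2.
D-square : ∀ q F B → D q (D q F) B ≡ D (q + q) F B
D-square q F []       = refl
D-square q F (x ∷ xs) = begin
  lower q (λ z → lower q h z xor D q (F ∘ (z ∷_)) xs) x
    xor D q (λ ys → lower q (λ z → F (z ∷ ys)) x xor D q (F ∘ (x ∷_)) ys) xs
    ≡⟨ cong₂ _xor_ (lower-xor q (lower q h) (λ z → D q (F ∘ (z ∷_)) xs) x)
                   (D-xor q (λ ys → lower q (λ z → F (z ∷ ys)) x) (D q (F ∘ (x ∷_))) xs) ⟩
  (a xor b) xor (D q (λ ys → lower q (λ z → F (z ∷ ys)) x) xs xor d)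
    ≡⟨ cong (λ c → (a xor b) xor (c xor d)) (D-lower-comm q q (λ z ys → F (z ∷ ys)) x xs) ⟩
  (a xor b) xor (b xor d)
    ≡⟨ xor-assoc a b (b xor d) ⟩
  a xor (b xor (b xor d))
    ≡⟨ cong (a xor_) (≡-trans (sym (xor-assoc b b d)) (cong (_xor d) (xor-same b))) ⟩
  a xor d
    ≡⟨ cong₂ _xor_ (lower-lower q q h x) (D-square q (F ∘ (x ∷_)) xs) ⟩
  D (q + q) F (x ∷ xs) ∎
  where
  open ≡-Reasoning
  h = λ z → F (z ∷ xs)
  a = lower q (lower q h) x
  b = lower q (λ z → D q (F ∘ (z ∷_)) xs) x
  d = D q (D q (F ∘ (x ∷_))) xs

-- An odd sum has an odd term. `C` keeps the lowered bead in its place in the list; for an `F`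
-- without symmetry the rearranged list `q ∷ R` could have another value.
D-true : ∀ p F B → D p F B ≡ true → ∃[ q ] ∃[ R ] (B ↭ (p + q) ∷ R × ∃[ C ] (C ↭ q ∷ R × F C ≡ true))
D-true p F (x ∷ xs) e with lower p (λ z → F (z ∷ xs)) x in eq
... | true with q , refl , Fq ← lower-true p _ x eq = q , xs , refl , q ∷ xs , refl , Fq
... | false with q , R , xs↭ , C , C↭ , FC ← D-true p _ xs e =
  q , x ∷ R , trans (prep x xs↭) (swap x _ refl) , x ∷ C , trans (prep x C↭) (swap x _ refl) , FC

Symmetric : (List ℕ → Bool) → Set
Symmetric F = ∀ {B C} → B ↭ C → F B ≡ F C

D-symmetric : ∀ p F → Symmetric F → Symmetric (D p F)
D-symmetric p F s refl = refl
D-symmetric p F s (prep {xs} x B↭C) =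
  cong₂ _xor_ (lower-cong p (λ z → s (prep z B↭C)) x) (D-symmetric p (F ∘ (x ∷_)) (s ∘ prep x) B↭C)
D-symmetric p F s (swap {xs} {ys} x y B↭C) = begin
  a xor (b xor D p (λ B → F (x ∷ y ∷ B)) xs)
    ≡⟨ cong (λ d → a xor (b xor d)) (≡-trans (D-symmetric p (λ B → F (x ∷ y ∷ B)) (s ∘ prep x ∘ prep y) B↭C)
                                            (D-cong p (λ B → s (swap x y refl)) ys)) ⟩
  a xor (b xor D p (λ B → F (y ∷ x ∷ B)) ys)
    ≡⟨ sym (xor-assoc a b _) ⟩
  (a xor b) xor D p (λ B → F (y ∷ x ∷ B)) ys
    ≡⟨ cong (_xor _) (≡-trans (xor-comm a b) (cong₂ _xor_ (lower-cong p (λ z → s (swap x z B↭C)) y)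
                                                         (lower-cong p (λ z → s (swap z y B↭C)) x))) ⟩
  (a′ xor b′) xor D p (λ B → F (y ∷ x ∷ B)) ys
    ≡⟨ xor-assoc a′ b′ _ ⟩
  a′ xor (b′ xor D p (λ B → F (y ∷ x ∷ B)) ys) ∎
  where
  open ≡-Reasoning
  a = lower p (λ z → F (z ∷ y ∷ xs)) x
  b = lower p (λ z → F (x ∷ z ∷ xs)) y
  a′ = lower p (λ z → F (z ∷ x ∷ ys)) y
  b′ = lower p (λ z → F (y ∷ z ∷ ys)) x
D-symmetric p F s (trans B↭C C↭E) = ≡-trans (D-symmetric p F s B↭C) (D-symmetric p F s C↭E)

-- Together with symmetry, this says that F is alternating mod 2.
Alternating : (List ℕ → Bool) → Set
Alternating F = ∀ x B → F (x ∷ x ∷ B) ≡ false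

-- Terms that lower neither copy of `x` vanish because `F` is alternating; the two that lower one
-- copy agree by symmetry and cancel.
D-alternating : ∀ p F → Symmetric F → Alternating F → Alternating (D p F)
D-alternating p F s alt x B = begin
  a xor (b xor D p (λ C → F (x ∷ x ∷ C)) B)
    ≡⟨ cong (λ d → a xor (b xor d)) (≡-trans (D-cong p (alt x) B) (D-false p B)) ⟩
  a xor (b xor false)
    ≡⟨ cong (a xor_) (xor-identityʳ b) ⟩
  a xor b
    ≡⟨ cong (a xor_) (lower-cong p (λ z → s (swap x z refl)) x) ⟩
  a xor a
    ≡⟨ xor-same a ⟩
  false ∎
  where
  open ≡-Reasoning
  a = lower p (λ z → F (z ∷ x ∷ B)) x
  b = lower p (λ z → F (x ∷ z ∷ B)) x

-- On bead sets of partitions of n, F n is the parity of f; distinct beads of weight 0 belong to the empty partition,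
-- so distinctness is all that F 0 has to test.
F : ℕ → List ℕ → Bool
F zero    B = does (unique? B)
F (suc n) B = D 1 (F n) B

F-symmetric : ∀ n → Symmetric (F n)
F-symmetric (suc n) p = D-symmetric 1 (F n) (F-symmetric n) p
F-symmetric zero {B} {C} p with unique? B
... | yes u = sym (dec-true (unique? C) (Unique-resp-↭ p u))
... | no ¬u = sym (dec-false (unique? C) (¬u ∘ Unique-resp-↭ (↭-sym p)))

F-alternating : ∀ n → Alternating (F n)
F-alternating zero x B = dec-false (unique? (x ∷ x ∷ B)) (λ u → unique-∉ u (here refl))
F-alternating (suc n) = D-alternating 1 (F n) (F-symmetric n) (F-alternating n)

F-zero : ∀ {B} → Unique B → F 0 B ≡ true
F-zero {B} u = dec-true (unique? B) u

F-resp : ∀ n {B C} → B ↭ C → F n B ≡ true → F n C ≡ true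
F-resp n p e = ≡-trans (sym (F-symmetric n p)) e

supported : ∀ G → Symmetric G → Alternating G → ∀ B → G B ≡ true → Unique B
supported G s alt []      e = []
supported G s alt (x ∷ B) e = unique-cons x∉B (supported (G ∘ (x ∷_)) (s ∘ prep x) alt′ B e)
  where
  false≢true : ∀ {b} → b ≡ false → b ≢ true
  false≢true refl ()
  x∉B : x ∉ B
  x∉B x∈B with R , B↭ ← extract x∈B =
    false≢true (alt x R) (≡-trans (sym (s (prep x B↭))) e)
  alt′ : Alternating (G ∘ (x ∷_))
  alt′ y C = ≡-trans (s (trans (swap x y refl) (prep y (swap x y refl)))) (alt y (x ∷ C))

F-unique : ∀ n {B} → F n B ≡ true → Unique B
F-unique n {B} = supported (F n) (F-symmetric n) (F-alternating n) B

iterate : ℕ → (List ℕ → Bool) → List ℕ → Bool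
iterate zero    G = G
iterate (suc n) G = D 1 (iterate n G)

iterate-+ : ∀ m n G B → iterate (m + n) G B ≡ iterate m (iterate n G) B
iterate-+ zero    n G B = refl
iterate-+ (suc m) n G B = D-cong 1 (iterate-+ m n G) B

-- Each doubling is one use of `D-square`. This restricts the hook lengths to powers of two and
-- makes the binary digits of the size govern oddness.
iterate-2^ : ∀ k G B → iterate (2 ^ k) G B ≡ D (2 ^ k) G B
iterate-2^ zero    G B = refl
iterate-2^ (suc k) G B rewrite +-identityʳ (2 ^ k) = begin
  iterate (p + p) G B          ≡⟨ iterate-+ p p G B ⟩
  iterate p (iterate p G) B    ≡⟨ iterate-2^ k (iterate p G) B ⟩
  D p (iterate p G) B          ≡⟨ D-cong p (iterate-2^ k G) B ⟩
  D p (D p G) B                ≡⟨ D-square p G B ⟩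
  D (p + p) G B                ∎
  where
  open ≡-Reasoning
  p = 2 ^ k

F-iterate : ∀ n r B → F (n + r) B ≡ iterate n (F r) B
F-iterate zero    r B = refl
F-iterate (suc n) r B = D-cong 1 (F-iterate n r) B

F-2^+ : ∀ k r B → F (2 ^ k + r) B ≡ D (2 ^ k) (F r) B
F-2^+ k r B = ≡-trans (F-iterate (2 ^ k) r B) (iterate-2^ k (F r) B)

-- Bead sets

Sorted : List ℕ → Set
Sorted = AllPairs _>_

data Insert (z : ℕ) : List ℕ → List ℕ → Set where
  here  : ∀ {B} → Insert z B (z ∷ B)
  there : ∀ {x B C} → z < x → Insert z B C → Insert z (x ∷ B) (x ∷ C)

insert-↭ : ∀ {z B C} → Insert z B C → C ↭ z ∷ B
insert-↭ here        = refl
insert-↭ (there _ i) = trans (prep _ (insert-↭ i)) (swap _ _ refl)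

insert : ∀ z B → Sorted B → z ∉ B → ∃[ C ] (Insert z B C × Sorted C)
insert z []      _        _   = _ , here , [] ∷ []
insert z (x ∷ B) (x> ∷ s) z∉B with <-cmp z x
... | tri≈ _ z≡x _ = ⊥-elim (z∉B (here z≡x))
... | tri> _ _ x<z = _ , here , (x<z ∷ All.map (λ y<x → <-trans y<x x<z) x>) ∷ x> ∷ s
... | tri< z<x _ _ with C , i , sC ← insert z B s (z∉B ∘ there) =
  x ∷ C , there z<x i , All-resp-↭ (↭-sym (insert-↭ i)) (z<x ∷ x>) ∷ sC

sort : ∀ B → Unique B → ∃[ C ] (Sorted C × C ↭ B)
sort []      _ = [] , [] , refl
sort (x ∷ B) u with C , s , C↭B ← sort B (unique-tail u)
  with E , i , sE ← insert x C s (λ x∈C → unique-∉ u (∈-resp-↭ C↭B x∈C)) =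
  E , sE , trans (insert-↭ i) (prep x C↭B)

sorted-head : ∀ {x C} → Sorted (x ∷ C) → length C ≤ x
sorted-head ([] ∷ _)        = z≤n
sorted-head ((y<x ∷ _) ∷ s) = ≤-trans (s≤s (sorted-head s)) y<x

sorted-sum : ∀ {C} → Sorted C → sum (downFrom (length C)) ≤ sum C
sorted-sum []          = z≤n
sorted-sum s@(_ ∷ sC) = +-mono-≤ (sorted-head s) (sorted-sum sC)

-- Distinct beads weigh least when packed onto 0, 1, 2, and so on. A removal that would leave less
-- is impossible; `core` and `hook-unique` both rest on this.
unique-sum : ∀ {B} → Unique B → sum (downFrom (length B)) ≤ sum B
unique-sum {B} u with C , s , C↭B ← sort B u
  rewrite sym (sum-↭ C↭B) | sym (↭-length C↭B) = sorted-sum s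

-- B is the bead set of a partition of n with (length B) parts, zero parts being allowed.
record Valid (n : ℕ) (B : List ℕ) : Set where
  constructor valid
  field
    distinct : Unique B
    weight   : sum B ≡ n + sum (downFrom (length B))

open Valid

valid-resp-↭ : ∀ {n B C} → B ↭ C → Valid n B → Valid n C
valid-resp-↭ B↭C (valid u e) = valid (Unique-resp-↭ B↭C u)
  (≡-trans (sym (sum-↭ B↭C)) (≡-trans e (cong (λ l → _ + sum (downFrom l)) (↭-length B↭C))))

valid-up : ∀ {n w R} → Valid n (w ∷ R) → Unique (suc w ∷ R) → Valid (suc n) (suc w ∷ R)
valid-up (valid _ e) u = valid u (cong suc e)

valid-down : ∀ {n w R} → Valid (suc n) (suc w ∷ R) → Unique (w ∷ R) → Valid n (w ∷ R)
valid-down (valid _ e) u = valid u (suc-injective e)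

valid-lower : ∀ p {r q R} → Valid (p + r) (p + q ∷ R) → q ∉ R → Valid r (q ∷ R)
valid-lower p {r} {q} {R} (valid u e) q∉R = valid (unique-cons q∉R (unique-tail u))
  (+-cancelˡ-≡ p _ _ (≡-trans (sym (+-assoc p q (sum R))) (≡-trans e (+-assoc p r _))))

excess-≤ : ∀ {u n s t} → u + s ≡ n + t → t ≤ s → u ≤ n
excess-≤ {u} {n} {s} {t} e t≤s = +-cancelʳ-≤ t u n (≤-trans (+-monoʳ-≤ u t≤s) (≤-reflexive e))

-- A partition of n < p is a p-core.
core : ∀ p {n q R} → n < p → Valid n (p + q ∷ R) → q ∈ R
core p {n} {q} {R} n<p (valid u e) with q ∈? R
... | yes q∈R = q∈R
... | no  q∉R = ⊥-elim (<⇒≱ n<p (excess-≤ (≡-trans (sym (+-assoc p q (sum R))) e)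
                                          (unique-sum (unique-cons q∉R (unique-tail u)))))

-- Removing two different p-hooks would leave a partition of n − 2p < 0.
hook-unique : ∀ p {n b c B Z Y} → n < p + p → Valid n B →
  B ↭ p + b ∷ Z → b ∉ Z → B ↭ p + c ∷ Y → c ∉ Y → b ≡ c
hook-unique p {n} {b} {c} {B} {Z} {Y} n<2p v B↭Z b∉Z B↭Y c∉Y with b ≟ c
... | yes b≡c = b≡c
... | no  b≢c with Q , Z↭ , Y↭ ← ∷-split (trans (↭-sym B↭Z) B↭Y) (b≢c ∘ +-cancelˡ-≡ p b c) =
  ⊥-elim (<⇒≱ n<2p (excess-≤ sum-eq (unique-sum unique)))
  where
  v′ : Valid n (p + b ∷ p + c ∷ Q)
  v′ = valid-resp-↭ (trans B↭Z (prep _ Z↭)) v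
  rearrange : ∀ p b c s → p + p + (b + (c + s)) ≡ (p + b) + ((p + c) + s)
  rearrange = solve-∀
  sum-eq : p + p + (b + (c + sum Q)) ≡ n + sum (downFrom (length (b ∷ c ∷ Q)))
  sum-eq = ≡-trans (rearrange p b c (sum Q)) (weight v′)
  unique : Unique (b ∷ c ∷ Q)
  unique = unique-cons (∉-cons b≢c (λ i → b∉Z (∈-resp-↭ (↭-sym Z↭) (there i))))
          (unique-cons (λ i → c∉Y (∈-resp-↭ (↭-sym Y↭) (there i)))
                       (unique-tail (unique-tail (distinct v′))))

-- Macdonald's recursion; 2 ^ k is the leading binary digit of the size.
F-remove : ∀ k {r q R} → r < 2 ^ k → Valid (2 ^ k + r) (2 ^ k + q ∷ R) → q ∉ R →
  F (2 ^ k + r) (2 ^ k + q ∷ R) ≡ F r (q ∷ R)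
F-remove k {r} {q} {R} r<p v q∉R = begin
  F (p + r) (p + q ∷ R)
    ≡⟨ F-2^+ k r (p + q ∷ R) ⟩
  lower p (λ z → F r (z ∷ R)) (p + q) xor D p (λ B → F r (p + q ∷ B)) R
    ≡⟨ cong₂ _xor_ (lower-+ p _ q) (¬-not no-other) ⟩
  F r (q ∷ R) xor false
    ≡⟨ xor-identityʳ _ ⟩
  F r (q ∷ R) ∎
  where
  open ≡-Reasoning
  p = 2 ^ k
  -- The size is below 2p, so any other bead with a nonzero term would start from the same position
  -- `p + q` and repeat it.
  no-other : D p (λ B → F r (p + q ∷ B)) R ≢ true
  no-other e with q′ , Q , R↭ , C , C↭ , FC ← D-true p _ R e =
    unique-∉ (distinct v) (subst (λ c → p + c ∈ R) (sym q≡q′) (∈-resp-↭ (↭-sym R↭) (here refl)))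
    where
    u : Unique (q′ ∷ p + q ∷ Q)
    u = Unique-resp-↭ (trans (prep _ C↭) (swap _ _ refl)) (F-unique r FC)
    q≡q′ : q ≡ q′
    q≡q′ = hook-unique p (+-monoʳ-< p r<p) v refl q∉R (trans (prep _ R↭) (swap _ _ refl)) (unique-∉ u)

F-remove⁻ : ∀ k {r B} → F (2 ^ k + r) B ≡ true → ∃[ q ] ∃[ R ] (B ↭ 2 ^ k + q ∷ R × F r (q ∷ R) ≡ true)
F-remove⁻ k {r} {B} e with q , R , B↭ , C , C↭ , FC ← D-true (2 ^ k) (F r) B (≡-trans (sym (F-2^+ k r B)) e) =
  q , R , B↭ , F-resp r C↭ FC

-- Odd covers under removal of the leading hook

-- The partial permutation of positions that interchanges s with p + s and t with p + t, where s and t are adjacent.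
data Swapped (p s t : ℕ) : ℕ → ℕ → Set where
  at-s : Swapped p s t (p + s) s
  at-t : Swapped p s t t (p + t)
  same : ∀ {w} → w ≢ p + s → w ≢ t → w ≢ s → w ≢ p + t → Swapped p s t w w

swapped-injective : ∀ {p s t w w′ x x′} → s ≢ p + t → Swapped p s t w x → Swapped p s t w′ x′ → x ≡ x′ → w ≡ w′
swapped-injective s≢ at-s            at-s           e = refl
swapped-injective s≢ at-s            at-t           e = ⊥-elim (s≢ e)
swapped-injective s≢ at-s            (same _ _ n _) e = ⊥-elim (n (sym e))
swapped-injective s≢ at-t            at-s           e = ⊥-elim (s≢ (sym e))
swapped-injective s≢ at-t            at-t           e = refl
swapped-injective s≢ at-t            (same _ _ _ n) e = ⊥-elim (n (sym e))
swapped-injective s≢ (same _ _ n _)  at-s           e = ⊥-elim (n e)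
swapped-injective s≢ (same _ _ _ n)  at-t           e = ⊥-elim (n e)
swapped-injective s≢ (same _ _ _ _)  (same _ _ _ _) e = e

swapped-functional : ∀ {p s t w w′ x x′} → p + s ≢ t → Swapped p s t w x → Swapped p s t w′ x′ → w ≡ w′ → x ≡ x′
swapped-functional s≢ at-s            at-s           e = refl
swapped-functional s≢ at-s            at-t           e = ⊥-elim (s≢ e)
swapped-functional s≢ at-s            (same n _ _ _) e = ⊥-elim (n (sym e))
swapped-functional s≢ at-t            at-s           e = ⊥-elim (s≢ (sym e))
swapped-functional s≢ at-t            at-t           e = refl
swapped-functional s≢ at-t            (same _ n _ _) e = ⊥-elim (n (sym e))
swapped-functional s≢ (same n _ _ _)  at-s           e = ⊥-elim (n e)
swapped-functional s≢ (same _ n _ _)  at-t           e = ⊥-elim (n e)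
swapped-functional s≢ (same _ _ _ _)  (same _ _ _ _) e = e

suc≢+ : ∀ {p a} → 1 < p → suc a ≢ p + a
suc≢+ {p} {a} 1<p e = <-irrefl e (+-monoˡ-< a 1<p)

+≢ : ∀ {p a} → 0 < p → p + a ≢ a
+≢ {p} {a} 0<p e = <-irrefl (sym e) (+-monoˡ-≤ a 0<p)

swap₂ : ∀ {x y : ℕ} {R} → x ∷ y ∷ R ↭ y ∷ x ∷ R
swap₂ = swap _ _ refl

rotate₃ : ∀ {x y z : ℕ} {R} → x ∷ y ∷ z ∷ R ↭ z ∷ x ∷ y ∷ R
rotate₃ = trans (prep _ swap₂) swap₂

-- If μ covers λ, the core of μ (beads b ∷ Z) covers the core of λ (beads suc a ∷ R).
core-covers : ∀ {p r a b w R R₁ Z} → suc r < p →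
  Valid r (suc a ∷ R) → Unique (p + suc a ∷ R) → Valid (p + suc r) (suc w ∷ R₁) →
  p + suc a ∷ R ↭ w ∷ R₁ → suc w ∷ R₁ ↭ p + b ∷ Z → b ∉ Z →
  ∃[ x ] ∃[ X ] (suc a ∷ R ↭ x ∷ X × suc x ∷ X ↭ b ∷ Z
    × Swapped p (suc a) a w x × Swapped p b (suc b) (suc w) (suc x))
core-covers {p} {r} {a} {b} {w} {R} {R₁} {Z} r<p vK uL vM L↭ M↭ b∉Z with p + suc a ≟ w
core-covers {p} {r} {a} {b} {w} {R} {R₁} {Z} r<p vK uL vM L↭ M↭ b∉Z | yes refl with suc w ≟ p + b
-- The raised bead is the one that the leading hook moves, so its landing position rises with it.
... | yes e = suc a , R , refl , subst (λ c → suc (suc a) ∷ R ↭ c ∷ Z) (sym b≡) (prep _ R↭Z) , at-s ,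
    subst (λ c → Swapped p c (suc c) (suc w) (suc (suc a))) (sym b≡)
      (subst (λ v → Swapped p (suc (suc a)) (suc (suc (suc a))) v (suc (suc a))) (+-suc p (suc a)) at-s)
  where
  b≡ : b ≡ suc (suc a)
  b≡ = +-cancelˡ-≡ p b (suc (suc a)) (≡-trans (sym e) (sym (+-suc p (suc a))))
  R↭Z : R ↭ Z
  R↭Z = trans (drop-∷ L↭) (drop-∷ (subst (λ v → suc w ∷ R₁ ↭ v ∷ Z) (sym e) M↭))
-- Here the hook of μ would move a bead `p + b` that already lies in K. As K is a p-core, `b` would
-- be occupied.
... | no ne with Q , R₁↭ , Z↭ ← ∷-split M↭ ne = ⊥-elim (absurd (core p (<-trans ≤-refl r<p) vK′))
  where
  R↭ : R ↭ p + b ∷ Q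
  R↭ = trans (drop-∷ L↭) R₁↭
  vK′ : Valid r (p + b ∷ suc a ∷ Q)
  vK′ = valid-resp-↭ (trans (prep _ R↭) swap₂) vK
  absurd : b ∉ suc a ∷ Q
  absurd (here refl) = unique-∉ uL (∈-resp-↭ (↭-sym R↭) (here refl))
  absurd (there b∈Q) = b∉Z (∈-resp-↭ (↭-sym Z↭) (there b∈Q))
core-covers {p} {r} {a} {b} {w} {R} {R₁} {Z} r<p vK uL vM L↭ M↭ b∉Z | no y≢w
  with Q , R↭ , R₁↭ ← ∷-split L↭ y≢w with w ≟ a
-- The raising stays clear of the hook: `suc a` is still free in μ, so by `hook-unique` the leading
-- hook of μ lands there too.
... | no w≢a = w , suc a ∷ Q , trans (prep _ R↭) swap₂ , perm , same (y≢w ∘ sym) w≢a w≢suca w≢p+a ,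
    subst (λ c → Swapped p c (suc c) (suc w) (suc w)) (sym b≡)
      (same sucw≢ (w≢suca ∘ suc-injective) (w≢a ∘ suc-injective) (λ e → y≢w (sym (suc-injective (≡-trans e (+-suc p (suc a)))))))
  where
  sa∉R : suc a ∉ R
  sa∉R = unique-∉ (distinct vK)
  w≢suca : w ≢ suc a
  w≢suca refl = sa∉R (∈-resp-↭ (↭-sym R↭) (here refl))
  vM′ : Valid (p + suc r) (suc w ∷ p + suc a ∷ Q)
  vM′ = valid-resp-↭ (prep _ R₁↭) vM
  sucw≢ : suc w ≢ p + suc a
  sucw≢ e = unique-∉ (distinct vM′) (here e)
  w≢p+a : w ≢ p + a
  w≢p+a refl = sucw≢ (sym (+-suc p a))
  b≡ : b ≡ suc a
  b≡ = hook-unique p (+-monoʳ-< p r<p) vM M↭ b∉Z (trans (prep _ R₁↭) swap₂)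
         (∉-cons (w≢a ∘ suc-injective ∘ sym) (λ i → sa∉R (∈-resp-↭ (↭-sym R↭) (there i))))
  Z↭ : Z ↭ suc w ∷ Q
  Z↭ = drop-∷ (trans (↭-sym M↭) (trans (trans (prep _ R₁↭) swap₂) (↭-reflexive (cong (λ c → p + c ∷ suc w ∷ Q) (sym b≡)))))
  perm : suc w ∷ suc a ∷ Q ↭ b ∷ Z
  perm = trans swap₂ (subst (λ c → suc a ∷ suc w ∷ Q ↭ c ∷ Z) (sym b≡) (prep _ (↭-sym Z↭)))
-- The collision: the raised bead fills `suc a`. As K is a p-core, the leading hook of μ can only
-- move `p + a` to the vacated `a`.
... | yes refl = cases (suc a ≟ p + b) (p + suc a ≟ p + b)
  where
  Result = ∃[ x ] ∃[ X ] (suc a ∷ R ↭ x ∷ X × suc x ∷ X ↭ b ∷ Z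
    × Swapped p (suc a) a a x × Swapped p b (suc b) (suc a) (suc x))
  1<p : 1 < p
  1<p = ≤-<-trans (s≤s z≤n) r<p
  M↭′ : suc a ∷ p + suc a ∷ Q ↭ p + b ∷ Z
  M↭′ = trans (prep _ (↭-sym R₁↭)) M↭
  vK′ : Valid r (suc a ∷ a ∷ Q)
  vK′ = valid-resp-↭ (prep _ R↭) vK
  cases : _ → _ → Result
  cases (yes e) _ = ⊥-elim (absurd (core p (<-trans ≤-refl r<p) (subst (λ v → Valid r (v ∷ a ∷ Q)) e vK′)))
    where
    Z↭ : p + suc a ∷ Q ↭ Z
    Z↭ = drop-∷ (subst (λ v → suc a ∷ p + suc a ∷ Q ↭ v ∷ Z) (sym e) M↭′)
    absurd : b ∉ a ∷ Q
    absurd (here refl) = suc≢+ 1<p e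
    absurd (there b∈Q) = b∉Z (∈-resp-↭ Z↭ (there b∈Q))
  cases (no ne) d with Q₁ , S↭ , Z↭ ← ∷-split M↭′ ne with d
  ... | yes e = ⊥-elim (b∉Z (∈-resp-↭ (↭-sym Z↭) (here (sym (+-cancelˡ-≡ p (suc a) b e)))))
  ... | no ne′ with Q₂ , Q↭ , Q₁↭ ← ∷-split S↭ ne′ = finish (core p (<-trans ≤-refl r<p) (valid-resp-↭ K↭ vK′))
    where
    K↭ : suc a ∷ a ∷ Q ↭ p + b ∷ suc a ∷ a ∷ Q₂
    K↭ = trans (prep _ (prep _ Q↭)) rotate₃
    Z↭′ : Z ↭ suc a ∷ p + suc a ∷ Q₂
    Z↭′ = trans Z↭ (prep _ Q₁↭)
    finish : b ∈ suc a ∷ a ∷ Q₂ → Result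
    finish (here refl) = ⊥-elim (b∉Z (∈-resp-↭ (↭-sym Z↭) (here refl)))
    finish (there (there i)) = ⊥-elim (b∉Z (∈-resp-↭ (↭-sym Z↭′) (there (there i))))
    finish (there (here refl)) = p + a , suc a ∷ a ∷ Q₂ , trans (prep _ R↭) K↭ ,
      trans (↭-reflexive (cong (_∷ suc a ∷ a ∷ Q₂) (sym (+-suc p a))))
        (trans rotate₃ (prep _ (trans swap₂ (↭-sym Z↭′)))) ,
      at-t , subst (Swapped p a (suc a) (suc a)) (+-suc p a) at-t

-- An odd cover is represented by the position of the bead that it raises. Counting covers becomes
-- counting numbers, which `Swapped` can match between partitions of different sizes.
OddUp : ℕ → List ℕ → ℕ → Set
OddUp n L w = ∃[ R ] (L ↭ w ∷ R × F (suc n) (suc w ∷ R) ≡ true)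

F-index : ∀ {m n B} → m ≡ n → F m B ≡ true → F n B ≡ true
F-index refl e = e

valid-index : ∀ {m n B} → m ≡ n → Valid m B → Valid n B
valid-index refl v = v

module Transfer (k : ℕ) {r a R} (r<p : suc r < 2 ^ k)
  (vL : Valid (2 ^ k + r) (2 ^ k + suc a ∷ R)) (sa∉R : suc a ∉ R) where

  private
    p = 2 ^ k
    vK : Valid r (suc a ∷ R)
    vK = valid-lower p vL sa∉R
    1<p : 1 < p
    1<p = ≤-<-trans (s≤s z≤n) r<p

  oddUp-core : ∀ {w} → OddUp (p + r) (p + suc a ∷ R) w →
    ∃[ x ] (Swapped p (suc a) a w x × OddUp r (suc a ∷ R) x)
  oddUp-core (R₁ , L↭ , odd) with b , Z , M↭ , odd′ ← F-remove⁻ k (F-index (sym (+-suc p r)) odd)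
    with x , X , K↭ , K′↭ , sw , _ ← core-covers r<p vK (distinct vL)
           (valid-index (sym (+-suc p r)) (valid-up (valid-resp-↭ L↭ vL) (F-unique (suc (p + r)) odd)))
           L↭ M↭ (unique-∉ (F-unique (suc r) odd′))
    = x , sw , X , K↭ , F-resp (suc r) (↭-sym K′↭) odd′

  private
    odd-lift : ∀ {w R₁ B b Z} → p + suc a ∷ R ↭ w ∷ R₁ → Unique (suc w ∷ R₁) → suc w ∷ R₁ ↭ p + b ∷ Z →
      B ↭ b ∷ Z → F (suc r) B ≡ true → F (suc (p + r)) (suc w ∷ R₁) ≡ true
    odd-lift L↭ uM M↭ B↭ odd = F-index (+-suc p r) (F-resp (p + suc r) (↭-sym M↭)
      (≡-trans (F-remove k r<p
        (valid-resp-↭ M↭ (valid-index (sym (+-suc p r)) (valid-up (valid-resp-↭ L↭ vL) uM)))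
        (unique-∉ (F-unique (suc r) odd′))) odd′))
      where odd′ = F-resp (suc r) B↭ odd

  -- Each case exhibits a hook of length `p` in the raised list whose removal leaves the raised
  -- core; `F-remove` then carries oddness upwards.
  oddUp-lift : ∀ {x} → OddUp r (suc a ∷ R) x → ∃[ w ] (Swapped p (suc a) a w x × OddUp (p + r) (p + suc a ∷ R) w)
  oddUp-lift {x} (X , K↭ , odd) with suc a ≟ x
  ... | yes refl = p + suc a , at-s , R , refl , odd-lift refl uM M↭ (prep _ (↭-sym (drop-∷ K↭))) odd
    where
    M↭ : suc (p + suc a) ∷ R ↭ p + suc (suc a) ∷ R
    M↭ = ↭-reflexive (cong (_∷ R) (sym (+-suc p (suc a))))
    -- R lies in the p-core suc a ∷ R, in which suc (suc a) carries no bead.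
    uM : Unique (suc (p + suc a) ∷ R)
    uM = unique-cons M∉ (unique-tail (distinct vL))
      where
      M∉ : suc (p + suc a) ∉ R
      M∉ i with Q , R↭ ← extract i = absurd (core p (<-trans ≤-refl r<p)
              (valid-resp-↭ (trans (prep _ (trans R↭ (↭-reflexive (cong (_∷ Q) (sym (+-suc p (suc a))))))) swap₂) vK))
        where
        absurd : suc (suc a) ∉ suc a ∷ Q
        absurd (here ())
        absurd (there j) = unique-∉ (F-unique (suc r) odd) (∈-resp-↭ (drop-∷ K↭) (∈-resp-↭ (↭-sym R↭) (there j)))
  ... | no sa≢x with Q , R↭ , X↭ ← ∷-split K↭ sa≢x with x ≟ p + a
  ... | no x≢p+a = x , same x≢y x≢a (sa≢x ∘ sym) x≢p+a , p + suc a ∷ Q , L↭ ,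
        odd-lift L↭ uM swap₂ (trans (prep _ X↭) swap₂) odd
    where
    L↭ : p + suc a ∷ R ↭ x ∷ p + suc a ∷ Q
    L↭ = trans (prep _ R↭) swap₂
    uK′ : Unique (suc x ∷ suc a ∷ Q)
    uK′ = Unique-resp-↭ (prep _ X↭) (F-unique (suc r) odd)
    x≢y : x ≢ p + suc a
    x≢y refl = unique-∉ (distinct vL) (∈-resp-↭ (↭-sym R↭) (here refl))
    x≢a : x ≢ a
    x≢a refl = unique-∉ uK′ (here refl)
    uM : Unique (suc x ∷ p + suc a ∷ Q)
    uM = unique-cons (∉-cons (λ e → x≢p+a (suc-injective (≡-trans e (+-suc p a)))) (unique-∉ uK′ ∘ there))
           (unique-tail (Unique-resp-↭ L↭ (distinct vL)))
  -- In K the bead `p + a` rises. As K is a p-core it also has a bead at `a`, and that one is raised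
  -- in L instead.
  ... | yes refl with core p (<-trans ≤-refl r<p) (valid-resp-↭ (trans (prep _ R↭) swap₂) vK)
  ... | here ()
  ... | there a∈Q with Q′ , Q↭ ← extract a∈Q =
        a , at-t , p + suc a ∷ p + a ∷ Q′ , L↭ , odd-lift L↭ uM rotate₃ B↭ odd
    where
    R↭′ : R ↭ p + a ∷ a ∷ Q′
    R↭′ = trans R↭ (prep _ Q↭)
    L↭ : p + suc a ∷ R ↭ a ∷ p + suc a ∷ p + a ∷ Q′
    L↭ = trans (prep _ R↭′) rotate₃
    uM : Unique (suc a ∷ p + suc a ∷ p + a ∷ Q′)
    uM = unique-cons
      (∉-cons (λ e → +≢ (<-trans z<s 1<p) (sym e))
        (λ { (here e) → suc≢+ 1<p e ; (there i) → sa∉R (∈-resp-↭ (↭-sym R↭′) (there (there i))) }))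
      (unique-tail (Unique-resp-↭ L↭ (distinct vL)))
    B↭ : suc (p + a) ∷ X ↭ a ∷ suc a ∷ p + suc a ∷ Q′
    B↭ = trans (prep _ (trans X↭ (prep _ Q↭)))
           (trans rotate₃ (prep _ (trans swap₂ (↭-reflexive (cong (λ v → suc a ∷ v ∷ Q′) (sym (+-suc p a)))))))

oddUp-resp-↭ : ∀ n {L L′ w} → L ↭ L′ → OddUp n L w → OddUp n L′ w
oddUp-resp-↭ n L↭L′ (R , L↭ , odd) = R , trans (↭-sym L↭L′) L↭ , odd

One Two Zero : ℕ → List ℕ → Set
One n L = ∃[ w ] (OddUp n L w × (∀ w′ → OddUp n L w′ → w′ ≡ w))
Two n L = ∃[ w₁ ] ∃[ w₂ ] (w₁ ≢ w₂ × OddUp n L w₁ × OddUp n L w₂ × (∀ w′ → OddUp n L w′ → w′ ≡ w₁ ⊎ w′ ≡ w₂))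
Zero n L = ∀ w → ¬ OddUp n L w

module TransferCounts (k : ℕ) {r a R L K} (r<p : suc r < 2 ^ k) (vL : Valid (2 ^ k + r) L)
  (L↭ : L ↭ 2 ^ k + suc a ∷ R) (K↭ : K ↭ suc a ∷ R) (sa∉R : suc a ∉ R) where

  private
    open Transfer k r<p (valid-resp-↭ L↭ vL) sa∉R
    p = 2 ^ k
    1<p : 1 < p
    1<p = ≤-<-trans (s≤s z≤n) r<p

    toCore : ∀ {w} → OddUp (p + r) L w → ∃[ x ] (Swapped p (suc a) a w x × OddUp r K x)
    toCore ou = let x , sw , ou′ = oddUp-core (oddUp-resp-↭ (p + r) L↭ ou) in x , sw , oddUp-resp-↭ r (↭-sym K↭) ou′

    fromCore : ∀ {x} → OddUp r K x → ∃[ w ] (Swapped p (suc a) a w x × OddUp (p + r) L w)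
    fromCore ou = let w , sw , ou′ = oddUp-lift (oddUp-resp-↭ r K↭ ou) in w , sw , oddUp-resp-↭ (p + r) (↭-sym L↭) ou′

    injective : ∀ {w w′ x x′} → Swapped p (suc a) a w x → Swapped p (suc a) a w′ x′ → x ≡ x′ → w ≡ w′
    injective = swapped-injective (suc≢+ 1<p)

    functional : ∀ {w w′ x x′} → Swapped p (suc a) a w x → Swapped p (suc a) a w′ x′ → w ≡ w′ → x ≡ x′
    functional = swapped-functional (λ e → <-irrefl (sym e) (m≤n+m (suc a) p))

  one-lift : One r K → One (p + r) L
  one-lift (x , ou , uniq) with w , sw , ou′ ← fromCore ou = w , ou′ , λ w′ o →
    let x′ , sw′ , o′ = toCore o in injective sw′ sw (uniq x′ o′)

  two-lift : Two r K → Two (p + r) L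
  two-lift (x₁ , x₂ , x₁≢x₂ , ou₁ , ou₂ , uniq) with w₁ , sw₁ , ou₁′ ← fromCore ou₁ | w₂ , sw₂ , ou₂′ ← fromCore ou₂ =
    w₁ , w₂ , (λ e → x₁≢x₂ (functional sw₁ sw₂ e)) , ou₁′ , ou₂′ , λ w′ o →
      let x′ , sw′ , o′ = toCore o in Sum.map (injective sw′ sw₁) (injective sw′ sw₂) (uniq x′ o′)

  zero-lift : Zero r K → Zero (p + r) L
  zero-lift none w o = let x , _ , o′ = toCore o in none x o′

-- Hooks, and sizes next to a power of two

-- A bead at `n + q` above a free `q` in a partition of `n` means that the whole diagram is one
-- hook. Its removal leaves the empty partition, which is odd.
F-2^ : ∀ k {n q R} → n ≡ 2 ^ k → Valid n (n + q ∷ R) → q ∉ R → F n (n + q ∷ R) ≡ true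
F-2^ k {n} {q} {R} refl v q∉R = F-index (+-identityʳ (2 ^ k))
  (≡-trans (F-remove k (m^n>0 2 k) (valid-index (sym (+-identityʳ (2 ^ k))) v) q∉R)
           (F-zero (unique-cons q∉R (unique-tail (distinct v)))))

F-2^⁻ : ∀ k {n B} → n ≡ 2 ^ k → F n B ≡ true → ∃[ q ] ∃[ R ] (B ↭ n + q ∷ R × q ∉ R)
F-2^⁻ k refl e with q , R , B↭ , e′ ← F-remove⁻ k (F-index (sym (+-identityʳ (2 ^ k))) e) =
  q , R , B↭ , unique-∉ (F-unique 0 e′)

-- An odd cover has size 2^k and is therefore a hook. The added cell lies at the end of its arm
-- (`w ≡ n + c`) or at the foot of its leg (`suc w ≡ c`).
oddUp-hook : ∀ k {n L w} → suc n ≡ 2 ^ k → Valid n L → OddUp n L w →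
  ∃[ c ] ∃[ R ] (L ↭ n + c ∷ R × c ∉ R × (w ≡ n + c ⊎ suc w ≡ c))
oddUp-hook k {n} {L} {w} eq v (R₁ , L↭ , odd) with b , Z , M↭ , b∉Z ← F-2^⁻ k eq odd with suc w ≟ suc n + b
... | yes e = b , R₁ , trans L↭ (↭-reflexive (cong (_∷ R₁) (suc-injective e))) ,
    (λ i → b∉Z (∈-resp-↭ (drop-∷ (subst (λ x → suc w ∷ R₁ ↭ x ∷ Z) (sym e) M↭)) i)) , inj₁ (suc-injective e)
... | no ne with Q , R₁↭ , Z↭ ← ∷-split M↭ ne
    with core (suc n) ≤-refl (valid-resp-↭ (trans L↭ (trans (prep _ R₁↭) swap₂)) v)
... | there b∈Q  = ⊥-elim (b∉Z (∈-resp-↭ (↭-sym Z↭) (there b∈Q)))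
-- The arm bead was there before the raising, so by `core` position `b` was occupied; only the
-- raised bead can have left it.
... | here refl = suc b , w ∷ Q , trans L↭ (trans (prep _ R₁↭) (trans swap₂ (↭-reflexive (cong (_∷ w ∷ Q) (sym (+-suc n b)))))) ,
    ∉-cons 1+n≢n (λ i → unique-∉ (Unique-resp-↭ (prep _ R₁↭) (F-unique (suc n) odd)) (there i)) , inj₂ refl

-- The bead at 0 stands for a zero part, the row in which the leg can grow. It forces the free
-- position of the hook to be positive, and the two covers extend the arm and the leg.
hook-two : ∀ k {n c L R} → suc n ≡ 2 ^ k → 0 < n → Valid n L → 0 ∈ L → L ↭ n + c ∷ R → c ∉ R → Two n L
hook-two k {n} {zero} eq n>0 v 0∈L L↭ c∉R with ∈-resp-↭ L↭ 0∈L
... | here e  = ⊥-elim (<-irrefl (≡-trans e (+-identityʳ n)) n>0)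
... | there i = ⊥-elim (c∉R i)
hook-two k {n} {suc c} {L} {R} eq n>0 v 0∈L L↭ c∉R =
  n + suc c , c , (λ e → <-irrefl (sym e) (m≤n+m (suc c) n)) , (R , L↭ , F-2^ k eq vM₁ c∉R) , second , only
  where
  vL : Valid n (n + suc c ∷ R)
  vL = valid-resp-↭ L↭ v
  v₀ : Valid 0 (suc c ∷ R)
  v₀ = valid-lower n (valid-index (sym (+-identityʳ n)) vL) c∉R
  -- L is a (suc n)-core in which suc c carries no bead.
  vM₁ : Valid (suc n) (suc n + suc c ∷ R)
  vM₁ = valid-up vL (unique-cons (λ i → absurd (extract i)) (unique-tail (distinct vL)))
    where
    absurd : ∃[ Q ] (R ↭ suc n + suc c ∷ Q) → ⊥
    absurd (Q , R↭) with core (suc n) ≤-refl (valid-resp-↭ (trans (prep _ R↭) swap₂) vL)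
    ... | here e  = <-irrefl e (m<n+m (suc c) n>0)
    ... | there j = c∉R (∈-resp-↭ (↭-sym R↭) (there j))
  second : OddUp n L c
  -- Removing the whole hook leaves the empty partition, a 1-core, so the position `c` just below
  -- `suc c` is occupied.
  second with Q , R↭ ← extract (core 1 z<s v₀) = n + suc c ∷ Q , L↭′ ,
      F-resp (suc n) (↭-sym M↭) (F-2^ k eq (valid-resp-↭ M↭ (valid-up (valid-resp-↭ L↭′ v) uM)) c∉)
    where
    L↭′ : L ↭ c ∷ n + suc c ∷ Q
    L↭′ = trans L↭ (trans (prep _ R↭) swap₂)
    M↭ : suc c ∷ n + suc c ∷ Q ↭ suc n + c ∷ suc c ∷ Q
    M↭ = trans swap₂ (↭-reflexive (cong (_∷ suc c ∷ Q) (+-suc n c)))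
    uM : Unique (suc c ∷ n + suc c ∷ Q)
    uM = unique-cons (∉-cons (λ e → <-irrefl e (m<n+m (suc c) n>0)) (λ i → c∉R (∈-resp-↭ (↭-sym R↭) (there i))))
           (unique-tail (Unique-resp-↭ L↭′ (distinct v)))
    c∉ : c ∉ suc c ∷ Q
    c∉ = unique-∉ (Unique-resp-↭ (trans (prep _ R↭) swap₂) (distinct v₀))
  only : ∀ w′ → OddUp n L w′ → w′ ≡ n + suc c ⊎ w′ ≡ c
  only w′ ou with c′ , R′ , L↭′ , c′∉ , d ← oddUp-hook k eq v ou
    with hook-unique n (m<m+n n n>0) v L↭′ c′∉ L↭ c∉R | d
  ... | refl | inj₁ e = inj₁ e
  ... | refl | inj₂ e = inj₂ (suc-injective e)

leading-digit : ∀ n → ∃[ k ] ∃[ r ] (suc n ≡ 2 ^ k + r × r < 2 ^ k)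
leading-digit zero = 0 , 0 , refl , ≤-refl
leading-digit (suc n) with k , r , e , r<p ← leading-digit n with suc r ≟ 2 ^ k
... | no  ne = k , suc r , ≡-trans (cong suc e) (sym (+-suc (2 ^ k) r)) , ≤∧≢⇒< r<p ne
... | yes e′ = suc k , 0 ,
  ≡-trans (cong suc e) (≡-trans (sym (+-suc (2 ^ k) r)) (≡-trans (cong (2 ^ k +_) (≡-trans e′ (sym (+-identityʳ _)))) (sym (+-identityʳ _)))) ,
  m^n>0 2 (suc k)

-- A hook has at most two removable cells, and its number of odd predecessors is odd.
pred-unique-2^ : ∀ k {n M w₁ w₂ R₁ R₂} → suc n ≡ 2 ^ k → F (suc n) M ≡ true → Valid (suc n) M →
  M ↭ suc w₁ ∷ R₁ → M ↭ suc w₂ ∷ R₂ → F n (w₁ ∷ R₁) ≡ true → F n (w₂ ∷ R₂) ≡ true → w₁ ≡ w₂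
pred-unique-2^ k {n} {M} {w₁} {w₂} {R₁} {R₂} eq odd v M↭₁ M↭₂ odd₁ odd₂
  with b , Z , M↭ , b∉Z ← F-2^⁻ k eq odd with w₁ ≟ w₂
... | yes e = e
... | no ne with Q , R₁↭ , R₂↭ ← ∷-split (trans (↭-sym M↭₁) M↭₂) (ne ∘ suc-injective) =
  -- `F (suc n)` of this list is the sum over all its beads. The first two contribute `true` each
  -- and the others nothing, so the sum would be `false`.
  ⊥-elim (contra (cong₂ _xor_ odd₁′ (cong₂ _xor_ odd₂′ (¬-not none))))
  where
  M↭₁₂ : M ↭ suc w₁ ∷ suc w₂ ∷ Q
  M↭₁₂ = trans M↭₁ (prep _ R₁↭)
  odd₁′ : F n (w₁ ∷ suc w₂ ∷ Q) ≡ true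
  odd₁′ = F-resp n (prep _ R₁↭) odd₁
  odd₂′ : F n (suc w₁ ∷ w₂ ∷ Q) ≡ true
  odd₂′ = F-resp n (trans (prep _ R₂↭) swap₂) odd₂
  contra : D 1 (F n) (suc w₁ ∷ suc w₂ ∷ Q) ≢ false
  contra e with () ← ≡-trans (sym e) (F-resp (suc n) M↭₁₂ odd)
  -- The end of the arm, or the foot of the leg.
  Corner : ℕ → Set
  Corner u = suc u ≡ suc n + b ⊎ u ≡ b
  corner : ∀ {u U} → M ↭ suc u ∷ U → u ∉ U → Corner u
  corner {u} {U} M↭U u∉U with suc n + b ≟ suc u
  ... | yes e = inj₁ (sym e)
  ... | no ne with S , Z↭ , U↭ ← ∷-split (trans (↭-sym M↭) M↭U) ne
      with core 1 z<s (valid-resp-↭ (trans (prep _ Z↭) swap₂)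
             (valid-lower (suc n) (valid-index (sym (+-identityʳ (suc n))) (valid-resp-↭ M↭ v)) b∉Z))
  ... | here u≡b  = inj₂ u≡b
  ... | there u∈S = ⊥-elim (u∉U (∈-resp-↭ (↭-sym U↭) (there u∈S)))
  pigeonhole : ∀ {x y z} → Corner x → Corner y → Corner z → x ≢ y → z ≢ x → z ≢ y → ⊥
  pigeonhole (inj₁ p) (inj₁ q) _        x≢y _   _   = x≢y (suc-injective (≡-trans p (sym q)))
  pigeonhole (inj₂ p) (inj₂ q) _        x≢y _   _   = x≢y (≡-trans p (sym q))
  pigeonhole (inj₁ p) (inj₂ q) (inj₁ r) _   z≢x _   = z≢x (suc-injective (≡-trans r (sym p)))
  pigeonhole (inj₁ p) (inj₂ q) (inj₂ r) _   _   z≢y = z≢y (≡-trans r (sym q))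
  pigeonhole (inj₂ p) (inj₁ q) (inj₁ r) _   _   z≢y = z≢y (suc-injective (≡-trans r (sym q)))
  pigeonhole (inj₂ p) (inj₁ q) (inj₂ r) _   z≢x _   = z≢x (≡-trans r (sym p))
  none : D 1 (λ C → F n (suc w₁ ∷ suc w₂ ∷ C)) Q ≢ true
  none e with u , S , Q↭ , C , C↭ , oddC ← D-true 1 _ Q e =
    pigeonhole (corner M↭₁ (unique-∉ (F-unique n odd₁))) (corner M↭₂ (unique-∉ (F-unique n odd₂)))
               (corner M↭u (unique-∉ uC)) ne
               (λ { refl → unique-∉ uM (there (∈-resp-↭ (↭-sym Q↭) (here refl))) })
               (λ { refl → unique-∉ (unique-tail uM) (∈-resp-↭ (↭-sym Q↭) (here refl)) })
    where
    uM : Unique (suc w₁ ∷ suc w₂ ∷ Q)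
    uM = Unique-resp-↭ M↭₁₂ (distinct v)
    M↭u : M ↭ suc u ∷ suc w₁ ∷ suc w₂ ∷ S
    M↭u = trans M↭₁₂ (trans (prep _ (prep _ Q↭)) rotate₃)
    uC : Unique (u ∷ suc w₁ ∷ suc w₂ ∷ S)
    uC = Unique-resp-↭ (trans (prep _ (prep _ C↭)) rotate₃) (F-unique n oddC)

-- Odd predecessors

-- The bead at 0 keeps the leading hook of the predecessor from landing at 0, so that it lands at
-- some `suc a`, as `core-covers` demands.
record OddPred (n : ℕ) (M : List ℕ) (w : ℕ) : Set where
  constructor oddPred
  field
    {rest}  : List ℕ
    perm    : M ↭ suc w ∷ rest
    zero∈   : 0 ∈ w ∷ rest
    odd     : F n (w ∷ rest) ≡ true

-- This is the use of the second correspondence in `core-covers`. It depends on `b` alone, a datum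
-- of `M`, and so can compare two predecessors; the first depends on `a`, which varies with the
-- predecessor.
oddPred-core : ∀ k {r M w b Z} → suc r < 2 ^ k → Valid (2 ^ k + suc r) M → M ↭ 2 ^ k + b ∷ Z → b ∉ Z →
  OddPred (2 ^ k + r) M w → ∃[ x ] (Swapped (2 ^ k) b (suc b) (suc w) (suc x) × OddPred r (b ∷ Z) x)
oddPred-core k {r} {M} {w} {b} {Z} r<p vM M↭ b∉Z (oddPred {R₁} M↭₁ 0∈L oddL)
  with vL ← valid-down (valid-resp-↭ M↭₁ (valid-index (+-suc (2 ^ k) r) vM)) (F-unique (2 ^ k + r) oddL)
  with q , R , L↭ , oddK ← F-remove⁻ k oddL with ∈-resp-↭ L↭ 0∈L
... | here 0≡ = ⊥-elim (<-irrefl 0≡ (≤-trans (m^n>0 2 k) (m≤m+n (2 ^ k) q)))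
... | there 0∈R with q
... | zero  = ⊥-elim (unique-∉ (F-unique r oddK) 0∈R)
... | suc a with x , X , K↭ , K′↭ , _ , sw ← core-covers r<p
        (valid-lower (2 ^ k) (valid-resp-↭ L↭ vL) (unique-∉ (F-unique r oddK)))
        (distinct (valid-resp-↭ L↭ vL)) (valid-resp-↭ M↭₁ vM) (↭-sym L↭) (trans (↭-sym M↭₁) M↭) b∉Z
  = x , sw , oddPred (↭-sym K′↭) (∈-resp-↭ K↭ (there 0∈R)) (F-resp r K↭ oddK)

pred-unique : ∀ n {M w₁ w₂} → F (suc n) M ≡ true → Valid (suc n) M → OddPred n M w₁ → OddPred n M w₂ → w₁ ≡ w₂
pred-unique = <-rec _ go
  where
  go : ∀ n → (∀ {m} → m < n → ∀ {M w₁ w₂} → F (suc m) M ≡ true → Valid (suc m) M → OddPred m M w₁ → OddPred m M w₂ → w₁ ≡ w₂) →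
       ∀ {M w₁ w₂} → F (suc n) M ≡ true → Valid (suc n) M → OddPred n M w₁ → OddPred n M w₂ → w₁ ≡ w₂
  go n rec odd v o₁ o₂ with leading-digit n
  ... | k , zero , e , _ =
    pred-unique-2^ k (≡-trans e (+-identityʳ _)) odd v (perm o₁) (perm o₂) (OddPred.odd o₁) (OddPred.odd o₂)
    where open OddPred using (perm)
  ... | k , suc r , e , r<p with refl ← suc-injective (≡-trans e (+-suc (2 ^ k) r))
    with b , Z , M↭ , odd′ ← F-remove⁻ k (F-index e odd)
    with x₁ , sw₁ , o₁′ ← oddPred-core k r<p (valid-index e v) M↭ (unique-∉ (F-unique (suc r) odd′)) o₁
       | x₂ , sw₂ , o₂′ ← oddPred-core k r<p (valid-index e v) M↭ (unique-∉ (F-unique (suc r) odd′)) o₂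
    = suc-injective (swapped-injective b≢ sw₁ sw₂ (cong suc (rec (m<n+m r (m^n>0 2 k)) odd′ v′ o₁′ o₂′)))
    where
    v′ = valid-lower (2 ^ k) (valid-resp-↭ M↭ (valid-index e v)) (unique-∉ (F-unique (suc r) odd′))
    b≢ : b ≢ 2 ^ k + suc b
    b≢ e = <-irrefl e (m≤n+m (suc b) (2 ^ k))

-- Partitions as bead sets

Decreasing : (ℕ → ℕ) → Set
Decreasing f = ∀ i → f (suc i) ≤ f i

-- The beads (first-column hook lengths) of a partition with parts f 0 ≥ f 1 ≥ … padded to m parts.
beads : ℕ → (ℕ → ℕ) → List ℕ
beads zero    f = []
beads (suc m) f = f 0 + m ∷ beads m (f ∘ suc)

beads-length : ∀ m f → length (beads m f) ≡ m
beads-length zero    f = refl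
beads-length (suc m) f = cong suc (beads-length m (f ∘ suc))

beads-cong : ∀ m {f g} → (∀ i → f i ≡ g i) → beads m f ≡ beads m g
beads-cong zero    e = refl
beads-cong (suc m) e = cong₂ _∷_ (cong (_+ m) (e 0)) (beads-cong m (e ∘ suc))

beads-[] : ∀ m → beads m (part []) ≡ downFrom m
beads-[] zero    = refl
beads-[] (suc m) = cong (m ∷_) (beads-[] m)

beads-injective : ∀ m {f g} → (∀ i → m ≤ i → f i ≡ g i) → beads m f ≡ beads m g → ∀ i → f i ≡ g i
beads-injective zero            tails e i = tails i z≤n
beads-injective (suc m) {f} {g} tails e zero    = +-cancelʳ-≡ m (f 0) (g 0) (proj₁ (∷-injective e))
beads-injective (suc m)         tails e (suc i) =
  beads-injective m (λ i m≤i → tails (suc i) (s≤s m≤i)) (proj₂ (∷-injective e)) i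

beads-bound : ∀ m {f c} → (∀ i → f i ≤ c) → All (_< c + m) (beads m f)
beads-bound zero            f≤c = []
beads-bound (suc m) {f} {c} f≤c =
  ≤-<-trans (+-monoˡ-≤ m (f≤c 0)) c+m< ∷ All.map (λ x< → <-trans x< c+m<) (beads-bound m (f≤c ∘ suc))
  where
  c+m< : c + m < c + suc m
  c+m< = +-monoʳ-< c ≤-refl

decreasing-bound : ∀ {f} → Decreasing f → ∀ i → f i ≤ f 0
decreasing-bound dec zero    = ≤-refl
decreasing-bound dec (suc i) = ≤-trans (dec i) (decreasing-bound dec i)

beads-sorted : ∀ m {f} → Decreasing f → Sorted (beads m f)
beads-sorted zero    dec = []
beads-sorted (suc m) dec = beads-bound m (λ i → decreasing-bound dec (suc i)) ∷ beads-sorted m (dec ∘ suc)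

sorted-unique : ∀ {B} → Sorted B → Unique B
sorted-unique = AllPairs.map (λ y<x e → <-irrefl (sym e) y<x)

sorted-↭⇒≡ : ∀ {B C} → Sorted B → Sorted C → B ↭ C → B ≡ C
sorted-↭⇒≡ {[]}    {C}     _        _        p = sym (↭-empty-inv (↭-sym p))
sorted-↭⇒≡ {x ∷ B} {[]}    _        _        p = ⊥-elim (¬x∷xs↭[] p)
sorted-↭⇒≡ {x ∷ B} {y ∷ C} (x> ∷ s) (y> ∷ t) p with x≡y
  where
  x≡y : x ≡ y
  x≡y with ∈-resp-↭ p (here refl) | ∈-resp-↭ (↭-sym p) (here refl)
  ... | here e    | _         = e
  ... | there _   | here e    = sym e
  ... | there x∈C | there y∈B = ⊥-elim (<-asym (All.lookup y> x∈C) (All.lookup x> y∈B))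
... | refl = cong (x ∷_) (sorted-↭⇒≡ s t (drop-∷ p))

linked⇒decreasing : ∀ {l} → Linked _≥_ l → Decreasing (part l)
linked⇒decreasing []        i       = z≤n
linked⇒decreasing [-]       i       = z≤n
linked⇒decreasing (y≤x ∷ _) zero    = y≤x
linked⇒decreasing (_ ∷ l)   (suc i) = linked⇒decreasing l i

decreasing⇒linked : ∀ l → Decreasing (part l) → Linked _≥_ l
decreasing⇒linked []          d = []
decreasing⇒linked (x ∷ [])    d = [-]
decreasing⇒linked (x ∷ y ∷ l) d = d 0 ∷ decreasing⇒linked (y ∷ l) (d ∘ suc)

part-injective : ∀ {la mu} → All (0 <_) la → All (0 <_) mu → (∀ i → part la i ≡ part mu i) → la ≡ mu
part-injective []       []       e = refl
part-injective []       (p ∷ ps) e = ⊥-elim (<-irrefl (e 0) p)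
part-injective (p ∷ ps) []       e = ⊥-elim (<-irrefl (sym (e 0)) p)
part-injective (_ ∷ ps) (_ ∷ qs) e = cong₂ _∷_ (e 0) (part-injective ps qs (e ∘ suc))

part-beyond : ∀ l i → length l ≤ i → part l i ≡ 0
part-beyond []      i       _       = refl
part-beyond (x ∷ l) (suc i) (s≤s h) = part-beyond l i h

length≤size : ∀ {la} → All (0 <_) la → length la ≤ size la
length≤size []       = z≤n
length≤size (p ∷ ps) = +-mono-≤ p (length≤size ps)

size≡0⇒[] : ∀ {la} → All (0 <_) la → size la ≡ 0 → la ≡ []
size≡0⇒[] {[]}         _ _ = refl
size≡0⇒[] {suc x ∷ la} _ ()
size≡0⇒[] {zero ∷ la} (() ∷ _) _

sum-beads : ∀ m la → length la ≤ m → sum (beads m (part la)) ≡ size la + sum (downFrom m)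
sum-beads m       []       _       = cong sum (beads-[] m)
sum-beads (suc m) (x ∷ la) (s≤s h) = begin
  x + m + sum (beads m (part la))           ≡⟨ cong (x + m +_) (sum-beads m la h) ⟩
  x + m + (size la + sum (downFrom m))      ≡⟨ +-assoc x m _ ⟩
  x + (m + (size la + sum (downFrom m)))    ≡⟨ cong (x +_) (sym (+-assoc m (size la) _)) ⟩
  x + (m + size la + sum (downFrom m))      ≡⟨ cong (λ s → x + (s + sum (downFrom m))) (+-comm m (size la)) ⟩
  x + (size la + m + sum (downFrom m))      ≡⟨ cong (x +_) (+-assoc (size la) m _) ⟩
  x + (size la + (m + sum (downFrom m)))    ≡⟨ sym (+-assoc x (size la) _) ⟩
  x + size la + sum (downFrom (suc m))      ∎
  where open ≡-Reasoning

valid-beads : ∀ m {la} → IsPartition la → length la ≤ m → Valid (size la) (beads m (part la))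
valid-beads m {la} (linked , _) h = valid
  (sorted-unique (beads-sorted m (linked⇒decreasing linked)))
  (≡-trans (sum-beads m la h) (cong (λ l → size la + sum (downFrom l)) (sym (beads-length m (part la)))))

beads-determines : ∀ m {la mu} → IsPartition la → IsPartition mu → length la ≤ m → length mu ≤ m →
  beads m (part la) ↭ beads m (part mu) → la ≡ mu
beads-determines m {la} {mu} (l₁ , p₁) (l₂ , p₂) h₁ h₂ e = part-injective p₁ p₂
  (beads-injective m (λ i m≤i → ≡-trans (part-beyond la i (≤-trans h₁ m≤i)) (sym (part-beyond mu i (≤-trans h₂ m≤i))))
    (sorted-↭⇒≡ (beads-sorted m (linked⇒decreasing l₁)) (beads-sorted m (linked⇒decreasing l₂)) e))

zero∈beads : ∀ m la → length la < m → 0 ∈ beads m (part la)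
zero∈beads (suc m) []       _       = subst (0 ∈_) (sym (beads-[] (suc m))) (∈-downFrom⁺ z<s)
zero∈beads (suc m) (x ∷ la) (s≤s h) = there (zero∈beads m la h)

part-dropZeros : ∀ {l} → Decreasing (part l) → ∀ i → part (dropZeros l) i ≡ part l i
part-dropZeros {[]}         d i       = refl
part-dropZeros {suc x ∷ l}  d zero    = refl
part-dropZeros {suc x ∷ l}  d (suc i) = part-dropZeros {l} (d ∘ suc) i
part-dropZeros {zero ∷ l}   d i       =
  ≡-trans (part-dropZeros {l} (d ∘ suc) i) (≡-trans (zeros (suc i)) (sym (zeros i)))
  where
  zeros : ∀ i → part (zero ∷ l) i ≡ 0
  zeros i = n≤0⇒n≡0 (decreasing-bound d i)

dropZeros-positive : ∀ l → All (0 <_) (dropZeros l)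
dropZeros-positive []          = []
dropZeros-positive (zero ∷ l)  = dropZeros-positive l
dropZeros-positive (suc x ∷ l) = z<s ∷ dropZeros-positive l

dropZeros-length : ∀ l → length (dropZeros l) ≤ length l
dropZeros-length []          = z≤n
dropZeros-length (zero ∷ l)  = m≤n⇒m≤1+n (dropZeros-length l)
dropZeros-length (suc x ∷ l) = s≤s (dropZeros-length l)

dropZeros-size : ∀ l → size (dropZeros l) ≡ size l
dropZeros-size []          = refl
dropZeros-size (zero ∷ l)  = dropZeros-size l
dropZeros-size (suc x ∷ l) = cong (suc x +_) (dropZeros-size l)

dropZeros-partition : ∀ {l} → Decreasing (part l) → IsPartition (dropZeros l)
dropZeros-partition {l} d =
  decreasing⇒linked _ (λ i → subst₂ _≤_ (sym (part-dropZeros {l} d (suc i))) (sym (part-dropZeros {l} d i)) (d i)) ,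
  dropZeros-positive l

unbeads : List ℕ → List ℕ
unbeads []      = []
unbeads (x ∷ C) = x ∸ length C ∷ unbeads C

beads-unbeads : ∀ {C} → Sorted C → beads (length C) (part (unbeads C)) ≡ C
beads-unbeads []            = refl
beads-unbeads s@(_ ∷ sC) = cong₂ _∷_ (m∸n+n≡m (sorted-head s)) (beads-unbeads sC)

unbeads-length : ∀ C → length (unbeads C) ≡ length C
unbeads-length []      = refl
unbeads-length (x ∷ C) = cong suc (unbeads-length C)

unbeads-linked : ∀ {C} → Sorted C → Linked _≥_ (unbeads C)
unbeads-linked []                    = []
unbeads-linked {x ∷ []}    _         = [-]
unbeads-linked {x ∷ y ∷ C} ((y<x ∷ _) ∷ s) = ∸-monoˡ-≤ (suc (length C)) y<x ∷ unbeads-linked s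

-- Sorting and undoing the shift gives parts with possible zeros at the end. Dropping these is
-- harmless, since `beads` sees a list only through `part`.
realize : ∀ m C → length C ≡ m → Unique C → ∃[ la ] (IsPartition la × length la ≤ m × beads m (part la) ↭ C)
realize _ C refl u with E , s , E↭C ← sort C u = dropZeros (unbeads E) , dropZeros-partition {unbeads E} d ,
  ≤-trans (dropZeros-length (unbeads E)) (≤-reflexive (≡-trans (unbeads-length E) (↭-length E↭C))) ,
  trans (↭-reflexive (≡-trans (cong (λ l → beads l (part (dropZeros (unbeads E)))) (sym (↭-length E↭C)))
                     (≡-trans (beads-cong (length E) (part-dropZeros {unbeads E} d)) (beads-unbeads s)))) E↭C
  where
  d : Decreasing (part (unbeads E))
  d = linked⇒decreasing (unbeads-linked s)

-- Parity of the number of tableaux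

oddᵇ : ℕ → Bool
oddᵇ zero    = false
oddᵇ (suc n) = not (oddᵇ n)

oddᵇ-+ : ∀ m n → oddᵇ (m + n) ≡ oddᵇ m xor oddᵇ n
oddᵇ-+ zero    n = refl
oddᵇ-+ (suc m) n = ≡-trans (cong not (oddᵇ-+ m n)) (not-distribˡ-xor (oddᵇ m) (oddᵇ n))

oddᵇ⇒%2 : ∀ n → oddᵇ n ≡ true → n % 2 ≡ 1
oddᵇ⇒%2 (suc zero)    _ = refl
oddᵇ⇒%2 (suc (suc n)) e = oddᵇ⇒%2 n (≡-trans (sym (not-involutive (oddᵇ n))) e)

%2⇒oddᵇ : ∀ n → n % 2 ≡ 1 → oddᵇ n ≡ true
%2⇒oddᵇ (suc zero)    _ = refl
%2⇒oddᵇ (suc (suc n)) e = cong (not ∘ not) (%2⇒oddᵇ n e)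

parity-sum : (ℕ → Bool) → ℕ → Bool
parity-sum h zero    = false
parity-sum h (suc n) = h 0 xor parity-sum (h ∘ suc) n

parity-sum-cong : ∀ n {h h′} → (∀ i → i < n → h i ≡ h′ i) → parity-sum h n ≡ parity-sum h′ n
parity-sum-cong zero    e = refl
parity-sum-cong (suc n) e = cong₂ _xor_ (e 0 z<s) (parity-sum-cong n (λ i i<n → e (suc i) (s≤s i<n)))

oddᵇ-sum : ∀ (g : ℕ → ℕ) n → oddᵇ (sum (map g (upTo n))) ≡ parity-sum (oddᵇ ∘ g) n
oddᵇ-sum g n = ≡-trans (cong (oddᵇ ∘ sum) (map-upTo g n)) (go g n)
  where
  go : ∀ g n → oddᵇ (sum (applyUpTo g n)) ≡ parity-sum (oddᵇ ∘ g) n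
  go g zero    = refl
  go g (suc n) = ≡-trans (oddᵇ-+ (g 0) _) (cong (oddᵇ (g 0) xor_) (go (g ∘ suc) n))

Supported : (List ℕ → Bool) → Set
Supported G = ∀ B → G B ≡ true → Unique B

-- The padding beads fill an initial segment, so lowering one collides with the next or falls below
-- 0. Hence `D` over all beads agrees with the recursion of `chains`, which visits nonzero rows
-- only.
D-downFrom : ∀ m G → Supported G → D 1 G (downFrom m) ≡ false
D-downFrom zero    G s = refl
D-downFrom (suc m) G s =
  cong₂ _xor_ (head m) (D-downFrom m (G ∘ (m ∷_)) (λ B e → unique-tail (s (m ∷ B) e)))
  where
  head : ∀ m → lower 1 (λ z → G (z ∷ downFrom m)) m ≡ false
  head zero    = refl
  head (suc m) = ¬-not (λ e → unique-∉ (s _ e) (here refl))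

D-beads : ∀ m G → Supported G → ∀ la → All (0 <_) la → length la ≤ m →
  D 1 G (beads m (part la)) ≡ parity-sum (λ i → G (beads m (part (decAt i la)))) (length la)
D-beads m       G s []           _        _       = ≡-trans (cong (D 1 G) (beads-[] m)) (D-downFrom m G s)
D-beads (suc m) G s (suc x ∷ la) (_ ∷ ps) (s≤s h) =
  cong (G (x + m ∷ beads m (part la)) xor_)
       (D-beads m (G ∘ (suc x + m ∷_)) (λ B e → unique-tail (s _ e)) la ps h)

weaklyDecᵇ⇒linked : ∀ l → weaklyDecᵇ l ≡ true → Linked _≥_ l
weaklyDecᵇ⇒linked []          _ = []
weaklyDecᵇ⇒linked (x ∷ [])    _ = [-]
weaklyDecᵇ⇒linked (x ∷ y ∷ l) e =
  ≤ᵇ⇒≤ y x (subst T (sym (∧-conicalˡ _ _ e)) tt) ∷ weaklyDecᵇ⇒linked (y ∷ l) (∧-conicalʳ (y ≤ᵇ x) _ e)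

linked⇒weaklyDecᵇ : ∀ {l} → Linked _≥_ l → weaklyDecᵇ l ≡ true
linked⇒weaklyDecᵇ []        = refl
linked⇒weaklyDecᵇ [-]       = refl
linked⇒weaklyDecᵇ (_∷_ {x} {y} y≤x l) with y ≤ᵇ x | ≤⇒≤ᵇ y≤x
... | true | _ = linked⇒weaklyDecᵇ l

-- Lowering one part of a partition spoils the order by at most one, and parts `x`, `suc x` in
-- consecutive rows have equal beads. So the order test in `chains` rejects exactly the moves on
-- which `F` vanishes.
Almost : List ℕ → Set
Almost = Linked (λ x y → y ≤ suc x)

decAt-almost : ∀ i {la} → Linked _≥_ la → Almost (decAt i la)
decAt-almost i       []          = []
decAt-almost zero    [-]         = [-]
decAt-almost (suc i) [-]         = [-]
decAt-almost zero    (_∷_ {x} y≤x l) = ≤-trans y≤x (m≤n+m∸n x 1) ∷ Linked.map m≤n⇒m≤1+n l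
decAt-almost (suc zero) {x ∷ y ∷ _} (y≤x ∷ l) = ≤-trans (m∸n≤m y 1) (m≤n⇒m≤1+n y≤x) ∷ decAt-almost zero l
decAt-almost (suc (suc i))     (y≤x ∷ l) = m≤n⇒m≤1+n y≤x ∷ decAt-almost (suc i) l

almost-unique⇒linked : ∀ m {l} → Almost l → length l ≤ m → Unique (beads m (part l)) → Linked _≥_ l
almost-unique⇒linked m []  _ _ = []
almost-unique⇒linked m [-] _ _ = [-]
almost-unique⇒linked (suc (suc m)) (_∷_ {x} {y} y≤1+x l) (s≤s h) u =
  s≤s⁻¹ (≤∧≢⇒< y≤1+x y≢) ∷ almost-unique⇒linked (suc m) l h (unique-tail u)
  where
  y≢ : y ≢ suc x
  y≢ refl = unique-∉ u (here (+-suc x m))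

decAt-length : ∀ i l → length (decAt i l) ≡ length l
decAt-length i       []      = refl
decAt-length zero    (x ∷ l) = refl
decAt-length (suc i) (x ∷ l) = cong suc (decAt-length i l)

decAt-size : ∀ i {la} → All (0 <_) la → i < length la → suc (size (decAt i la)) ≡ size la
decAt-size zero    {suc x ∷ la} (_ ∷ _)  _       = refl
decAt-size (suc i) {x ∷ la}     (_ ∷ ps) (s≤s h) =
  ≡-trans (sym (+-suc x _)) (cong (x +_) (decAt-size i ps h))

chains-parity : ∀ k m {la} → IsPartition la → length la ≤ m → size la ≡ k →
  oddᵇ (chains k la) ≡ F k (beads m (part la))
chains-parity zero m {la} P@(_ , pos) h e with refl ← size≡0⇒[] pos e =
  sym (F-zero (distinct (valid-beads m P h)))
chains-parity (suc k) m {la} (linked , pos) h e = begin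
  oddᵇ (chains (suc k) la)
    ≡⟨ oddᵇ-sum _ (length la) ⟩
  parity-sum _ (length la)
    ≡⟨ parity-sum-cong (length la) term ⟩
  parity-sum (λ i → F k (beads m (part (decAt i la)))) (length la)
    ≡⟨ D-beads m (F k) (λ B → F-unique k) la pos h ⟨
  F (suc k) (beads m (part la)) ∎
  where
  open ≡-Reasoning
  term : ∀ i → i < length la →
    oddᵇ (if weaklyDecᵇ (decAt i la) then chains k (dropZeros (decAt i la)) else 0) ≡ F k (beads m (part (decAt i la)))
  term i i< with weaklyDecᵇ (decAt i la) in eq
  ... | true  = ≡-trans
    (chains-parity k m (dropZeros-partition {decAt i la} d)
      (≤-trans (dropZeros-length (decAt i la)) (≤-trans (≤-reflexive (decAt-length i la)) h))
      (≡-trans (dropZeros-size (decAt i la)) (suc-injective (≡-trans (decAt-size i pos i<) e))))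
    (cong (F k) (beads-cong m (part-dropZeros {decAt i la} d)))
    where
    d : Decreasing (part (decAt i la))
    d = linked⇒decreasing (weaklyDecᵇ⇒linked (decAt i la) eq)
  ... | false = sym (¬-not (λ odd → false≢true (≡-trans (sym eq) (linked⇒weaklyDecᵇ
      (almost-unique⇒linked m (decAt-almost i linked) (≤-trans (≤-reflexive (decAt-length i la)) h) (F-unique k odd))))))
    where
    false≢true : false ≢ true
    false≢true ()

odd⇒F : ∀ m {la n} → IsPartition la → length la ≤ m → size la ≡ n → IsOdd la → F n (beads m (part la)) ≡ true
odd⇒F m {la} P h refl odd = ≡-trans (sym (chains-parity (size la) m P h refl)) (%2⇒oddᵇ (numSYT la) odd)

F⇒odd : ∀ m {la n} → IsPartition la → length la ≤ m → size la ≡ n → F n (beads m (part la)) ≡ true → IsOdd la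
F⇒odd m {la} P h refl e = oddᵇ⇒%2 (numSYT la) (≡-trans (chains-parity (size la) m P h refl) e)

-- Rim hooks and bead moves

Skew : (ℕ → ℕ) → (ℕ → ℕ) → Cell → Set
Skew f g (i , j) = g i ≤ j × j < f i

-- f/g is a rim hook whose top row is row 0.
data Rim (f g : ℕ → ℕ) : Set where
  last : g 0 < f 0 → (∀ i → f (suc i) ≡ g (suc i)) → Rim f g
  more : f 1 ≡ suc (g 0) → f 1 ≤ f 0 → Rim (f ∘ suc) (g ∘ suc) → Rim f g

data RimBelow (f g : ℕ → ℕ) : Set where
  top  : Rim f g → RimBelow f g
  skip : f 0 ≡ g 0 → RimBelow (f ∘ suc) (g ∘ suc) → RimBelow f g

rim-contained : ∀ {f g} → Rim f g → ∀ i → g i ≤ f i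
rim-contained (last g<f eq)   zero    = <⇒≤ g<f
rim-contained (last g<f eq)   (suc i) = ≤-reflexive (sym (eq i))
rim-contained {f} {g} (more eq f≤ r) zero = ≤-trans (n≤1+n (g 0)) (≤-trans (≤-reflexive (sym eq)) f≤)
rim-contained (more eq f≤ r)  (suc i) = rim-contained r i

rimBelow-contained : ∀ {f g} → RimBelow f g → ∀ i → g i ≤ f i
rimBelow-contained (top r)     i       = rim-contained r i
rimBelow-contained (skip eq r) zero    = ≤-reflexive (sym eq)
rimBelow-contained (skip eq r) (suc i) = rimBelow-contained r i

rim-no-square : ∀ {f g} → Rim f g → ∀ i j → Skew f g (i , j) → ¬ Skew f g (suc i , suc j)
rim-no-square (last _ eq)   i       j _       (g≤ , <f) = <⇒≱ <f (≤-trans (≤-reflexive (eq i)) g≤)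
rim-no-square (more eq _ _) zero    j (g≤ , _) (_ , <f) = <⇒≱ <f (≤-trans (≤-reflexive eq) (s≤s g≤))
rim-no-square (more _ _ r)  (suc i) j s       t         = rim-no-square r i j s t

rimBelow-no-square : ∀ {f g} → RimBelow f g → ∀ i j → Skew f g (i , j) → ¬ Skew f g (suc i , suc j)
rimBelow-no-square (top r)     i       j s         t = rim-no-square r i j s t
rimBelow-no-square (skip eq r) zero    j (g≤ , <f) t = <⇒≱ <f (≤-trans (≤-reflexive eq) g≤)
rimBelow-no-square (skip eq r) (suc i) j s         t = rimBelow-no-square r i j s t

path-++ : ∀ {S c d e} → Path S c d → Path S d e → Path S c e
path-++ (here _)     q = q
path-++ (step s a p) q = step s a (path-++ p q)

path-source : ∀ {S c d} → Path S c d → S c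
path-source (here s)     = s
path-source (step s _ _) = s

adj-sym : ∀ {c d} → Adj c d → Adj d c
adj-sym right = left
adj-sym left  = right
adj-sym down  = up
adj-sym up    = down

path-reverse : ∀ {S c d} → Path S c d → Path S d c
path-reverse (here s)     = here s
path-reverse (step s a p) = path-++ (path-reverse p) (step (path-source p) (adj-sym a) (here s))

path-shift : ∀ {f g i j i′ j′} → Path (Skew (f ∘ suc) (g ∘ suc)) (i , j) (i′ , j′) →
  Path (Skew f g) (suc i , j) (suc i′ , j′)
path-shift (here s)         = here s
path-shift (step s right p) = step s right (path-shift p)
path-shift (step s left p)  = step s left (path-shift p)
path-shift (step s down p)  = step s down (path-shift p)
path-shift (step s up p)    = step s up (path-shift p)

row-path : ∀ {f g t} → f 0 ≡ suc t → ∀ d j → d + j ≡ t → g 0 ≤ j → Path (Skew f g) (0 , j) (0 , t)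
row-path eq zero    j refl g≤j = here (g≤j , ≤-reflexive (sym eq))
row-path eq (suc d) j refl g≤j = step (g≤j , ≤-trans (s≤s (m≤n+m j (suc d))) (≤-reflexive (sym eq))) right
  (row-path eq d (suc j) (+-suc d j) (m≤n⇒m≤1+n g≤j))

-- Every cell is joined to the right end of the top row; connectedness follows by going through that
-- cell.
rim-path : ∀ {f g t} → Rim f g → f 0 ≡ suc t → ∀ i j → Skew f g (i , j) → Path (Skew f g) (i , j) (0 , t)
rim-path {t = t} r eq zero j (g≤j , j<f) =
  row-path eq (t ∸ j) j (m∸n+n≡m (s≤s⁻¹ (≤-trans j<f (≤-reflexive eq)))) g≤j
rim-path (last _ e) eq (suc i) j (g≤j , j<f) = ⊥-elim (<⇒≱ j<f (≤-trans (≤-reflexive (e i)) g≤j))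
-- Row 1 ends in column `g 0`, directly below the first cell of row 0.
rim-path {f} {g} {t} (more e f≤ r) eq (suc i) j s =
  path-++ (path-shift p) (step (path-source (path-reverse (path-shift {f} {g} p))) up
    (row-path eq (t ∸ g 0) (g 0) (m∸n+n≡m g≤t) ≤-refl))
  where
  p : Path (Skew (f ∘ suc) (g ∘ suc)) (i , j) (0 , g 0)
  p = rim-path r e i j s
  g≤t : g 0 ≤ t
  g≤t = s≤s⁻¹ (≤-trans (≤-reflexive (sym e)) (≤-trans f≤ (≤-reflexive eq)))

rim-top : ∀ {f g} → Rim f g → ∃[ t ] (f 0 ≡ suc t)
rim-top {f} {g} r with f 0 in eq
... | suc t = t , refl
rim-top {f} {g} (last g<f _)  | zero = ⊥-elim (n≮0 (≤-trans g<f (≤-reflexive eq)))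
rim-top {f} {g} (more e f≤ _) | zero = ⊥-elim (n≮0 (≤-trans (≤-reflexive (sym e)) (≤-trans f≤ (≤-reflexive eq))))

rimBelow-connected : ∀ {f g} → RimBelow f g → ∀ c d → Skew f g c → Skew f g d → Path (Skew f g) c d
rimBelow-connected (top r) (i , j) (i′ , j′) s s′ with t , eq ← rim-top r =
  path-++ (rim-path r eq i j s) (path-reverse (rim-path r eq i′ j′ s′))
rimBelow-connected (skip eq r) (zero , _) _ (g≤ , <f) _ = ⊥-elim (<⇒≱ <f (≤-trans (≤-reflexive eq) g≤))
rimBelow-connected (skip eq r) (suc _ , _) (zero , _) _ (g≤ , <f) = ⊥-elim (<⇒≱ <f (≤-trans (≤-reflexive eq) g≤))
rimBelow-connected (skip eq r) (suc i , j) (suc i′ , j′) s s′ = path-shift (rimBelow-connected r (i , j) (i′ , j′) s s′)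

-- Row i of λ/ν occupies the contents between bead i of ν and bead i of λ; an insertion makes these intervals abut.
insert⇒rim : ∀ m {f g z B C} → Insert z B C → B ≡ beads m (f ∘ suc) → C ≡ beads (suc m) g →
  z < f 0 + m → Decreasing f → (∀ i → suc m ≤ i → f i ≡ g i) → Rim f g
insert⇒rim m {f} {g} here eB eC z< dec tails with refl , eC′ ← ∷-injective eC =
  last (+-cancelʳ-< m (g 0) (f 0) z<)
       (beads-injective m (λ i h → tails (suc i) (s≤s h)) (≡-trans (sym eB) eC′))
insert⇒rim (suc m) {f} {g} (there z<x i) eB eC z< dec tails
  with refl , eB′ ← ∷-injective eB | eg , eC′ ← ∷-injective eC =
  more (+-cancelʳ-≡ m (f 1) (suc (g 0)) (≡-trans eg (+-suc (g 0) m))) (dec 0)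
       (insert⇒rim m i eB′ eC′ z<x (dec ∘ suc) (λ i h → tails (suc i) (s≤s h)))

move⇒rimBelow : ∀ m {f g y z R} → Decreasing f → Decreasing g → (∀ i → m ≤ i → f i ≡ g i) → z < y →
  beads m f ↭ y ∷ R → beads m g ↭ z ∷ R → RimBelow f g
move⇒rimBelow zero df dg tails z<y f↭ g↭ = ⊥-elim (¬x∷xs↭[] (↭-sym f↭))
move⇒rimBelow (suc m) {f} {g} {y} {z} {R} df dg tails z<y f↭ g↭ with f 0 + m ≟ y
... | yes refl with f′↭ ← drop-∷ f↭
    with C , ins , sC ← insert z (beads m (f ∘ suc)) (beads-sorted m (df ∘ suc))
           (λ i → unique-∉ (Unique-resp-↭ g↭ (sorted-unique (beads-sorted (suc m) dg))) (∈-resp-↭ f′↭ i))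
  = top (insert⇒rim m ins refl
      (sorted-↭⇒≡ sC (beads-sorted (suc m) dg) (trans (insert-↭ ins) (trans (prep z f′↭) (↭-sym g↭)))) z<y df tails)
-- A largest bead that is not the moved one remains largest, because the moved bead only goes down;
-- so row 0 is unchanged.
... | no ne with Q , f′↭ , R↭ ← ∷-split f↭ ne = skip f0≡g0
    (move⇒rimBelow m (df ∘ suc) (dg ∘ suc) (λ i h → tails (suc i) (s≤s h)) z<y f′↭
      (drop-∷ (subst (λ x → x + m ∷ beads m (g ∘ suc) ↭ f 0 + m ∷ z ∷ Q) (sym f0≡g0) g↭′)))
  where
  g↭′ : g 0 + m ∷ beads m (g ∘ suc) ↭ f 0 + m ∷ z ∷ Q
  g↭′ = trans g↭ (trans (prep z R↭) (swap _ _ refl))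
  below-f : ∀ {x} → x ∈ beads m (f ∘ suc) → x < f 0 + m
  below-f = All.lookup (AllPairs.head (beads-sorted (suc m) df))
  below-g : ∀ {x} → x ∈ g 0 + m ∷ beads m (g ∘ suc) → x ≤ g 0 + m
  below-g (here refl) = ≤-refl
  below-g (there i)   = <⇒≤ (All.lookup (AllPairs.head (beads-sorted (suc m) dg)) i)
  g≤f : g 0 + m ∈ f 0 + m ∷ z ∷ Q → g 0 + m ≤ f 0 + m
  g≤f (here e)             = ≤-reflexive e
  g≤f (there (here refl))  = <⇒≤ (<-trans z<y (below-f (∈-resp-↭ (↭-sym f′↭) (here refl))))
  g≤f (there (there i))    = <⇒≤ (below-f (∈-resp-↭ (↭-sym f′↭) (there i)))
  f0≡g0 : f 0 ≡ g 0
  f0≡g0 = +-cancelʳ-≡ m (f 0) (g 0)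
    (≤-antisym (below-g (∈-resp-↭ (↭-sym g↭′) (here refl))) (g≤f (∈-resp-↭ g↭′ (here refl))))

rimHook : ∀ m p {q la nu R} → 0 < p → IsPartition la → IsPartition nu → length la ≤ m → length nu ≤ m →
  beads m (part la) ↭ p + q ∷ R → beads m (part nu) ↭ q ∷ R → IsRimHookRemoval p la nu
rimHook m p {q} {la} {nu} {R} p>0 (ll , _) P@(ln , _) hl hn la↭ nu↭ =
  P , rimBelow-contained rim , sizes , rimBelow-connected rim ,
  λ i j (s , _ , _ , t) → rimBelow-no-square rim i j s t
  where
  rim : RimBelow (part la) (part nu)
  rim = move⇒rimBelow m (linked⇒decreasing ll) (linked⇒decreasing ln)
    (λ i h → ≡-trans (part-beyond la i (≤-trans hl h)) (sym (part-beyond nu i (≤-trans hn h))))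
    (m<n+m q p>0) la↭ nu↭
  open ≡-Reasoning
  base = sum (downFrom m)
  sizes : size la ≡ size nu + p
  sizes = +-cancelʳ-≡ base _ _ (begin
    size la + base             ≡⟨ sum-beads m la hl ⟨
    sum (beads m (part la)) ≡⟨ sum-↭ la↭ ⟩
    p + q + sum R           ≡⟨ +-assoc p q (sum R) ⟩
    p + sum (q ∷ R)         ≡⟨ cong (p +_) (sum-↭ nu↭) ⟨
    p + sum (beads m (part nu)) ≡⟨ cong (p +_) (sum-beads m nu hn) ⟩
    p + (size nu + base)       ≡⟨ +-assoc p (size nu) base ⟨
    p + size nu + base         ≡⟨ cong (_+ base) (+-comm p (size nu)) ⟩
    size nu + p + base         ∎)

covers-beads : ∀ m {w la mu R} → IsPartition la → IsPartition mu → length la ≤ m → length mu ≤ m →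
  beads m (part la) ↭ w ∷ R → beads m (part mu) ↭ suc w ∷ R → Covers la mu
covers-beads m Pl Pm hl hm la↭ mu↭ with _ , contained , sizes , _ ← rimHook m 1 z<s Pm Pl hm hl mu↭ la↭ =
  Pm , contained , ≡-trans sizes (+-comm _ 1)

beads-mono : ∀ m {f g} → (∀ i → f i ≤ g i) → sum (beads m f) ≤ sum (beads m g)
beads-mono zero    f≤g = z≤n
beads-mono (suc m) f≤g = +-mono-≤ (+-monoˡ-≤ m (f≤g 0)) (beads-mono m (f≤g ∘ suc))

beads-rigid : ∀ m {f g} → (∀ i → f i ≤ g i) → sum (beads m g) ≤ sum (beads m f) → beads m f ≡ beads m g
beads-rigid zero            f≤g s≤ = refl
beads-rigid (suc m) {f} {g} f≤g s≤ = cong₂ _∷_ head≡ (beads-rigid m (f≤g ∘ suc)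
    (+-cancelˡ-≤ (f 0 + m) _ _ (≤-trans (≤-reflexive (cong (_+ sum (beads m (g ∘ suc))) head≡)) s≤)))
  where
  head≡ : f 0 + m ≡ g 0 + m
  head≡ = ≤-antisym (+-monoˡ-≤ m (f≤g 0))
    (+-cancelʳ-≤ (sum (beads m (f ∘ suc))) _ _ (≤-trans (+-monoʳ-≤ (g 0 + m) (beads-mono m (f≤g ∘ suc))) s≤))

-- Containment compares the beads row by row, so a total surplus of one is used up in the first row
-- that differs and `beads-rigid` makes the later rows agree.
beads-step : ∀ m {f g} → (∀ i → f i ≤ g i) → sum (beads m g) ≡ suc (sum (beads m f)) →
  ∃[ w ] ∃[ R ] (beads m f ↭ w ∷ R × beads m g ↭ suc w ∷ R)
beads-step (suc m) {f} {g} f≤g e with f 0 ≟ g 0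
... | yes f0≡g0 with w , R , f↭ , g↭ ← beads-step m (f≤g ∘ suc)
      (+-cancelˡ-≡ (f 0 + m) _ _ (≡-trans (cong (λ x → x + m + sum (beads m (g ∘ suc))) f0≡g0) (≡-trans e (sym (+-suc (f 0 + m) _)))))
    = w , f 0 + m ∷ R , trans (prep _ f↭) (swap _ _ refl) ,
      trans (↭-reflexive (cong (λ x → x + m ∷ beads m (g ∘ suc)) (sym f0≡g0))) (trans (prep _ g↭) (swap _ _ refl))
... | no f0≢g0 = f 0 + m , beads m (f ∘ suc) , refl , ↭-reflexive (cong₂ _∷_ head≡ (sym tail≡))
  where
  head≤ : suc (f 0 + m) ≤ g 0 + m
  head≤ = +-monoˡ-≤ m (≤∧≢⇒< (f≤g 0) f0≢g0)
  tail≡ : beads m (f ∘ suc) ≡ beads m (g ∘ suc)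
  tail≡ = beads-rigid m (f≤g ∘ suc) (+-cancelˡ-≤ (suc (f 0 + m)) _ _
    (≤-trans (+-monoˡ-≤ _ head≤) (≤-reflexive e)))
  head≡ : g 0 + m ≡ suc (f 0 + m)
  head≡ = +-cancelʳ-≡ (sum (beads m (g ∘ suc))) _ _ (≡-trans e (cong (λ l → suc (f 0 + m) + sum l) tail≡))

covers⇒beads : ∀ m la mu → length la ≤ m → length mu ≤ m → Covers la mu →
  ∃[ w ] ∃[ R ] (beads m (part la) ↭ w ∷ R × beads m (part mu) ↭ suc w ∷ R)
covers⇒beads m la mu hl hm (_ , contained , sizes) = beads-step m contained
  (≡-trans (sum-beads m mu hm) (≡-trans (cong (_+ sum (downFrom m)) sizes) (cong suc (sym (sum-beads m la hl)))))

remove : ∀ m p {q la R} → 0 < p → IsPartition la → length la ≤ m → beads m (part la) ↭ p + q ∷ R → q ∉ R →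
  ∃[ nu ] (IsPartition nu × length nu ≤ m × beads m (part nu) ↭ q ∷ R × IsRimHookRemoval p la nu)
remove m p {q} {la} {R} p>0 Pl hl la↭ q∉R
  with nu , Pn , hn , nu↭ ← realize m (q ∷ R) (≡-trans (sym (↭-length la↭)) (beads-length m (part la)))
         (unique-cons q∉R (unique-tail (Unique-resp-↭ la↭ (distinct (valid-beads m Pl hl)))))
  = nu , Pn , hn , nu↭ , rimHook m p p>0 Pl Pn hl hn la↭ nu↭

chain-++ : ∀ {p la mu nu} → RimHookChain p la mu → RimHookChain p mu nu → RimHookChain p la nu
chain-++ done      d = d
chain-++ (rem r c) d = rem r (chain-++ c d)

-- A hook of length 2p is removed by two p-hooks; if the bead to be moved is blocked half-way, the blocking bead goes first.
chain-2^ : ∀ m v j {q la nu R} → IsPartition la → IsPartition nu → length la ≤ m → length nu ≤ m →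
  beads m (part la) ↭ 2 ^ (j + v) + q ∷ R → q ∉ R → beads m (part nu) ↭ q ∷ R → RimHookChain (2 ^ v) la nu
chain-2^ m v zero Pl Pn hl hn la↭ q∉R nu↭ = rem (rimHook m (2 ^ v) (m^n>0 2 v) Pl Pn hl hn la↭ nu↭) done
chain-2^ m v (suc j) {q} {la} {nu} {R} Pl Pn hl hn la↭ q∉R nu↭ = go (P + q ∈? R)
  where
  P = 2 ^ (j + v)
  P>0 : 0 < P
  P>0 = m^n>0 2 (j + v)
  la↭′ : beads m (part la) ↭ P + (P + q) ∷ R
  la↭′ = trans la↭ (↭-reflexive (cong (_∷ R) (≡-trans (+-assoc P (P + 0) q) (cong (λ x → P + (x + q)) (+-identityʳ P)))))
  q≢P+ : ∀ x → q ≤ x → q ≢ P + x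
  q≢P+ x q≤x e = <-irrefl e (≤-<-trans q≤x (m<n+m x P>0))
  go : _ → RimHookChain (2 ^ v) la nu
  go (no P+q∉R) with mid , Pm , hm , mid↭ , _ ← remove m P P>0 Pl hl la↭′ P+q∉R =
    chain-++ (chain-2^ m v j Pl Pm hl hm la↭′ P+q∉R mid↭) (chain-2^ m v j Pm Pn hm hn mid↭ q∉R nu↭)
  go (yes P+q∈R) with Q , R↭ ← extract P+q∈R
    with la↭″ ← trans la↭′ (trans (prep _ R↭) swap₂)
       | q∉ ← ∉-cons {R = Q} (q≢P+ (P + q) (m≤n+m q P)) (λ i → q∉R (∈-resp-↭ (↭-sym R↭) (there i)))
    with mid , Pm , hm , mid↭ , _ ← remove m P P>0 Pl hl la↭″ q∉ =
    chain-++ (chain-2^ m v j Pl Pm hl hm la↭″ q∉ mid↭)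
             (chain-2^ m v j Pm Pn hm hn (trans mid↭ swap₂) P+q∉ (trans nu↭ (trans (prep _ R↭) swap₂)))
    where
    P+q∉ : P + q ∉ q ∷ Q
    P+q∉ = ∉-cons (λ e → q≢P+ q ≤-refl (sym e))
      (unique-∉ (Unique-resp-↭ R↭ (unique-tail (Unique-resp-↭ la↭ (distinct (valid-beads m Pl hl))))))

flat⇒hook : ∀ {x la} → IsPartition (x ∷ la) → part la 0 ≤ 1 → IsHook (x ∷ la)
flat⇒hook {suc x} {la} (linked , _ ∷ pos) h = x , length la , cong (suc x ∷_) (ones pos bound)
  where
  bound : ∀ i → part la i ≤ 1
  bound i = ≤-trans (decreasing-bound (linked⇒decreasing linked ∘ suc) i) h
  ones : ∀ {l} → All (0 <_) l → (∀ i → part l i ≤ 1) → l ≡ replicate (length l) 1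
  ones []       _ = refl
  ones (p ∷ ps) b = cong₂ _∷_ (≤-antisym (b 0) p) (ones ps (b ∘ suc))

-- The removed rim hook has all `n` cells, so it is the diagram itself. A rim hook contains no 2 × 2
-- square, hence the second row has at most one cell.
bead⇒hook : ∀ m {n c la R} → 0 < n → IsPartition la → length la ≤ m → size la ≡ n →
  beads m (part la) ↭ n + c ∷ R → c ∉ R → IsHook la
bead⇒hook m {n} {c} {la} n>0 P h e la↭ c∉R
  with nu , Pn , _ , _ , _ , _ , sizes , _ , no-square ← remove m n n>0 P h la↭ c∉R
  with refl ← size≡0⇒[] (proj₂ Pn) (+-cancelʳ-≡ n (size nu) 0 (≡-trans (sym sizes) e)) with la
... | []     = ⊥-elim (<-irrefl e n>0)
... | x ∷ l = flat⇒hook P (≮⇒≥ λ 1<y →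
    let 1<x = ≤-trans 1<y (linked⇒decreasing (proj₁ P) 0) in
    no-square 0 0 ((z≤n , <-trans z<s 1<x) , (z≤n , <-trans z<s 1<y) , (z≤n , 1<x) , (z≤n , 1<y)))

-- The `b` ones occupy the positions from M down to M - b + 1, and the zero parts those below M - b.
column-gap : ∀ b M → b ≤ M → M ∸ b ∉ beads M (part (replicate b 1))
column-gap zero    M       _       i = <-irrefl refl (∈-downFrom⁻ (subst (M ∈_) (beads-[] M) i))
column-gap (suc b) (suc M) (s≤s h) = ∉-cons (λ e → <-irrefl e (s≤s (m∸n≤m M b))) (column-gap b M h)

hook⇒bead : ∀ m {la} → IsHook la → length la ≤ m → ∃[ c ] ∃[ R ] (beads m (part la) ↭ size la + c ∷ R × c ∉ R)
hook⇒bead (suc M) (a , b , refl) (s≤s h) = M ∸ b , beads M (part (replicate b 1)) ,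
  ↭-reflexive (cong (_∷ beads M (part (replicate b 1))) position) , column-gap b M b≤M
  where
  column-size : ∀ b → sum (replicate b 1) ≡ b
  column-size zero    = refl
  column-size (suc b) = cong suc (column-size b)
  b≤M : b ≤ M
  b≤M = ≤-trans (≤-reflexive (sym (length-replicate b))) h
  position : suc a + M ≡ suc a + sum (replicate b 1) + (M ∸ b)
  position = ≡-trans (cong (suc a +_) (≡-trans (sym (m+[n∸m]≡n b≤M)) (cong (_+ (M ∸ b)) (sym (column-size b)))))
                     (sym (+-assoc (suc a) _ (M ∸ b)))

-- Induction on the size

strip : ∀ m k {r la} → IsPartition la → length la < m → size la ≡ 2 ^ k + r → F (2 ^ k + r) (beads m (part la)) ≡ true →
  ∃[ a ] ∃[ R ] ∃[ nu ] (IsPartition nu × length nu ≤ m × size nu ≡ r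
    × beads m (part la) ↭ 2 ^ k + suc a ∷ R × suc a ∉ R × beads m (part nu) ↭ suc a ∷ R
    × F r (beads m (part nu)) ≡ true)
strip m k {r} {la} P h e odd with F-remove⁻ k odd
... | zero , R , la↭ , odd′ = ⊥-elim (absurd (∈-resp-↭ la↭ (zero∈beads m la h)))
  where
  absurd : 0 ∉ 2 ^ k + 0 ∷ R
  absurd (here 0≡)   = <-irrefl 0≡ (≤-trans (m^n>0 2 k) (m≤m+n (2 ^ k) 0))
  absurd (there 0∈R) = unique-∉ (F-unique r odd′) 0∈R
... | suc a , R , la↭ , odd′ with nu , Pn , hn , nu↭ , _ , _ , sizes , _ ← remove m (2 ^ k) (m^n>0 2 k) P (<⇒≤ h) la↭ (unique-∉ (F-unique r odd′))
  = a , R , nu , Pn , hn , size≡ , la↭ , unique-∉ (F-unique r odd′) , nu↭ , F-resp r (↭-sym nu↭) odd′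
  where
  size≡ : size nu ≡ r
  size≡ = +-cancelʳ-≡ (2 ^ k) (size nu) r (≡-trans (sym sizes) (≡-trans e (+-comm (2 ^ k) r)))

2^∣2^ : ∀ {i j} → i ≤ j → 2 ^ i ∣ 2 ^ j
2^∣2^ {i} {j} i≤j = divides (2 ^ (j ∸ i)) (≡-trans (cong (2 ^_) (sym (m∸n+n≡m i≤j))) (^-distribˡ-+-* 2 (j ∸ i) i))

2∤1 : ¬ 2 ∣ 1
2∤1 d with () ← ∣1⇒≡1 d

one-empty : ∀ M → One 0 (beads (suc M) (part []))
one-empty M = subst (One 0) (sym (beads-[] (suc M))) (M , (downFrom M , refl , F-2^ 0 refl vM M∉) , only)
  where
  v₀ : Valid 0 (M ∷ downFrom M)
  v₀ = subst (Valid 0) (beads-[] (suc M)) (valid-beads (suc M) ([] , []) z≤n)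
  M∉ : M ∉ downFrom M
  M∉ i = <-irrefl refl (∈-downFrom⁻ i)
  vM : Valid 1 (suc M ∷ downFrom M)
  vM = valid-up v₀ (unique-cons (λ i → 1+n≰n (<⇒≤ (∈-downFrom⁻ i))) (unique-tail (distinct v₀)))
  only : ∀ w → OddUp 0 (M ∷ downFrom M) w → w ≡ M
  only w (R , L↭ , odd) with w ≟ M
  ... | yes e = e
  ... | no ne with ∈-downFrom⁻ {suc M} (∈-resp-↭ (↭-sym L↭) (here refl))
  ... | s≤s w≤M with ∈-resp-↭ L↭ (∈-downFrom⁺ {suc M} (s≤s (≤∧≢⇒< w≤M ne)))
  ... | there i = ⊥-elim (unique-∉ (F-unique 1 odd) i)
  ... | here e  = ⊥-elim (1+n≢n e)

-- `m` stays fixed while `n` shrinks, since a partition and what remains of it must be read with the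
-- same number of beads; `n < m` supplies the bead at 0 throughout.
EvenCase : ℕ → Set
EvenCase n = ∀ m {la} → IsPartition la → size la ≡ n → n < m → 2 ∣ n →
  F n (beads m (part la)) ≡ true → One n (beads m (part la))

even-case : ∀ n → EvenCase n
even-case = <-rec EvenCase go
  where
  go : ∀ n → (∀ {r} → r < n → EvenCase r) → EvenCase n
  go zero    rec (suc M) P e n<m 2∣n odd with refl ← size≡0⇒[] (proj₂ P) e = one-empty M
  go (suc n) rec m {la} P e n<m 2∣n odd with leading-digit n
  ... | zero , zero , refl , _ = ⊥-elim (2∤1 2∣n)
  ... | zero , suc r , _ , s≤s ()
  ... | suc k , r , eq , r<p
    with a , R , nu , Pn , hn , sn , la↭ , sa∉R , nu↭ , odd′ ←
      strip m (suc k) P (≤-<-trans (≤-trans (length≤size (proj₂ P)) (≤-reflexive e)) n<m) (≡-trans e eq) (F-index eq odd)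
    = subst (λ n → One n (beads m (part la))) (sym eq)
        (TransferCounts.one-lift (suc k) sr<p vL la↭ nu↭ sa∉R (rec r<n m Pn sn (<-trans r<n n<m) 2∣r odd′))
    where
    p = 2 ^ suc k
    2∣p : 2 ∣ p
    2∣p = m∣m*n (2 ^ k)
    2∣r : 2 ∣ r
    2∣r = ∣m+n∣m⇒∣n (subst (2 ∣_) eq 2∣n) 2∣p
    -- As `p` and `r` are even, `suc r` cannot reach `p`: the descent ends only at the empty
    -- partition.
    sr<p : suc r < p
    sr<p = ≤∧≢⇒< r<p (λ e → 2∤1 (∣m+n∣m⇒∣n (subst (2 ∣_) (+-comm 1 r) (subst (2 ∣_) (sym e) 2∣p)) 2∣r))
    r<n : r < suc n
    r<n = ≤-trans (m<n+m r (m^n>0 2 (suc k))) (≤-reflexive (sym eq))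
    vL : Valid (p + r) (beads m (part la))
    vL = valid-index (≡-trans e eq) (valid-beads m P (≤-trans (length≤size (proj₂ P)) (≤-trans (≤-reflexive e) (<⇒≤ n<m))))

-- The last two divisibility conditions say that `v` is the 2-adic valuation of `suc n`. Above the
-- final stage the removed hook has length 2^k with v < k, so the valuation survives each removal
-- and the removal splits into removals of 2^v-hooks.
OddCase : ℕ → Set
OddCase n = ∀ m v {la} → IsPartition la → size la ≡ n → n < m → 2 ∣ suc n → 2 ^ v ∣ suc n → ¬ 2 ^ suc v ∣ suc n →
  F n (beads m (part la)) ≡ true →
  ∃[ ka ] (IsCore (2 ^ v) la ka × (IsHook ka → Two n (beads m (part la))) × (¬ IsHook ka → Zero n (beads m (part la))))

odd-case : ∀ n → OddCase n
odd-case = <-rec OddCase go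
  where
  go : ∀ n → (∀ {r} → r < n → OddCase r) → OddCase n
  go zero    rec m v P e n<m 2∣ _ _ odd = ⊥-elim (2∤1 2∣)
  go (suc n) rec m v {la} P e n<m 2∣ 2^v∣ 2^sv∤ odd with k , r , eq , r<p ← leading-digit n with suc r ≟ 2 ^ k
  ... | yes sr≡p = la , (done , no-hook) , two , zero′
    where
    h : length la < m
    h = ≤-<-trans (≤-trans (length≤size (proj₂ P)) (≤-reflexive e)) n<m
    eq′ : suc (suc n) ≡ 2 ^ suc k
    eq′ = ≡-trans (cong suc eq) (≡-trans (sym (+-suc (2 ^ k) r)) (cong (2 ^ k +_) (≡-trans sr≡p (sym (+-identityʳ _)))))
    vL : Valid (suc n) (beads m (part la))
    vL = valid-index e (valid-beads m P (<⇒≤ h))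
    sk≤v : suc k ≤ v
    sk≤v = ≮⇒≥ λ v<sk → 2^sv∤ (subst (2 ^ suc v ∣_) (sym eq′) (2^∣2^ v<sk))
    -- A diagram with 2^(k+1) - 1 cells has no room for a hook of 2^v ≥ 2^(k+1) cells.
    no-hook : ∀ nu → ¬ IsRimHookRemoval (2 ^ v) la nu
    no-hook nu (_ , _ , sizes , _) = <-irrefl refl (begin-strict
      suc n          ≡⟨ e ⟨
      size la        <⟨ ≤-reflexive (cong suc e) ⟩
      suc (suc n)    ≡⟨ eq′ ⟩
      2 ^ suc k      ≤⟨ ^-monoʳ-≤ 2 sk≤v ⟩
      2 ^ v          ≤⟨ m≤n+m (2 ^ v) (size nu) ⟩
      size nu + 2 ^ v ≡⟨ sizes ⟨
      size la        ≡⟨ e ⟩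
      suc n          ∎)
      where open ≤-Reasoning
    two : IsHook la → Two (suc n) (beads m (part la))
    two hook with c , R , la↭ , c∉R ← hook⇒bead m hook (<⇒≤ h) =
      hook-two (suc k) eq′ z<s vL (zero∈beads m la h) (subst (λ s → beads m (part la) ↭ s + c ∷ R) e la↭) c∉R
    zero′ : ¬ IsHook la → Zero (suc n) (beads m (part la))
    zero′ ¬hook w ou = let c , R , la↭ , c∉R , _ = oddUp-hook (suc k) eq′ vL ou in
      ¬hook (bead⇒hook m z<s P (<⇒≤ h) e la↭ c∉R)
  ... | no sr≢p
    with a , R , nu , Pn , hn , sn , la↭ , sa∉R , nu↭ , odd′ ←
      strip m k P (≤-<-trans (≤-trans (length≤size (proj₂ P)) (≤-reflexive e)) n<m) (≡-trans e eq) (F-index eq odd)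
    = let ka , (chain , final) , two , zero′ = rec r<n m v Pn sn (<-trans r<n n<m) 2∣sr 2^v∣sr 2^sv∤sr odd′ in
      ka , (chain-++ (chain-2^ m v (k ∸ v) P Pn h hn
              (subst (λ j → beads m (part la) ↭ 2 ^ j + suc a ∷ R) (sym (m∸n+n≡m (<⇒≤ v<k))) la↭) sa∉R nu↭) chain , final) ,
      (λ hook → subst (λ n → Two n (beads m (part la))) (sym eq) (two-lift (two hook))) ,
      (λ ¬hook → subst (λ n → Zero n (beads m (part la))) (sym eq) (zero-lift (zero′ ¬hook)))
    where
    p = 2 ^ k
    sr<p : suc r < p
    sr<p = ≤∧≢⇒< r<p sr≢p
    r<n : r < suc n
    r<n = ≤-trans (m<n+m r (m^n>0 2 k)) (≤-reflexive (sym eq))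
    h : length la ≤ m
    h = ≤-trans (length≤size (proj₂ P)) (≤-trans (≤-reflexive e) (<⇒≤ n<m))
    vL : Valid (p + r) (beads m (part la))
    vL = valid-index (≡-trans e eq) (valid-beads m P h)
    open TransferCounts k sr<p vL la↭ nu↭ sa∉R
    eq′ : suc (suc n) ≡ p + suc r
    eq′ = ≡-trans (cong suc eq) (sym (+-suc p r))
    restrict : ∀ {d} → d ∣ p → d ∣ suc (suc n) → d ∣ suc r
    restrict {d} d∣p d∣ = ∣m+n∣m⇒∣n (subst (d ∣_) eq′ d∣) d∣p
    -- If k ≤ v, then `p` would divide the positive number `suc r`, which is smaller.
    v<k : v < k
    v<k = ≰⇒> λ k≤v → <⇒≱ sr<p (∣⇒≤ (restrict ∣-refl (∣-trans (2^∣2^ k≤v) 2^v∣)))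
    2∣sr : 2 ∣ suc r
    2∣sr = restrict (2^∣2^ {1} (≤-trans (s≤s z≤n) v<k)) 2∣
    2^v∣sr : 2 ^ v ∣ suc r
    2^v∣sr = restrict (2^∣2^ (<⇒≤ v<k)) 2^v∣
    2^sv∤sr : ¬ 2 ^ suc v ∣ suc r
    2^sv∤sr d = 2^sv∤ (subst (2 ^ suc v ∣_) (sym eq′) (∣m∣n⇒∣m+n (2^∣2^ v<k) d))

-- From positions back to partitions

module Bridge {n la} m (P : IsPartition la) (e : size la ≡ n) (n<m : n < m) where

  private
    L = beads m (part la)
    h : length la ≤ m
    h = ≤-trans (length≤size (proj₂ P)) (≤-trans (≤-reflexive e) (<⇒≤ n<m))

  record OddCover (mu : List ℕ) (w : ℕ) : Set where
    constructor oddCover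
    field
      covers : Covers la mu
      isOdd  : IsOdd mu
      {rest} : List ℕ
      lower↭ : L ↭ w ∷ rest
      upper↭ : beads m (part mu) ↭ suc w ∷ rest

  private
    cover-length : ∀ {mu} → Covers la mu → length mu ≤ m
    cover-length ((_ , pos) , _ , sizes) = ≤-trans (length≤size pos) (≤-trans (≤-reflexive (≡-trans sizes (cong suc e))) n<m)

  position : ∀ {mu} → Covers la mu → IsOdd mu → ∃[ w ] OddCover mu w
  position {mu} cov odd with w , R , la↭ , mu↭ ← covers⇒beads m la mu h (cover-length cov) cov = w , oddCover cov odd la↭ mu↭

  oddCover⇒oddUp : ∀ {mu w} → OddCover mu w → OddUp n L w
  oddCover⇒oddUp (oddCover cov@(Pm , _ , sizes) odd la↭ mu↭) =
    _ , la↭ , F-resp (suc n) mu↭ (odd⇒F m Pm (cover-length cov) (≡-trans sizes (cong suc e)) odd)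

  oddUp⇒oddCover : ∀ {w} → OddUp n L w → ∃[ mu ] OddCover mu w
  oddUp⇒oddCover {w} (R , la↭ , odd) =
    let mu , Pm , hm , mu↭ = realize m (suc w ∷ R) (≡-trans (sym (↭-length la↭)) (beads-length m (part la))) (F-unique (suc n) odd)
        cov = covers-beads m P Pm h hm la↭ mu↭
    in mu , oddCover cov (F⇒odd m Pm hm (≡-trans (proj₂ (proj₂ cov)) (cong suc e)) (F-resp (suc n) (↭-sym mu↭) odd)) la↭ mu↭

  cover-unique : ∀ {mu mu′ w w′} → OddCover mu w → OddCover mu′ w′ → w ≡ w′ → mu ≡ mu′
  cover-unique (oddCover c₁ _ la↭₁ mu↭₁) (oddCover c₂ _ la↭₂ mu↭₂) refl =
    beads-determines m (proj₁ c₁) (proj₁ c₂) (cover-length c₁) (cover-length c₂)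
      (trans mu↭₁ (trans (prep _ (drop-∷ (trans (↭-sym la↭₁) la↭₂))) (↭-sym mu↭₂)))

  -- Raising a bead vacates its position. If `w` and `w′` differed, raising `w` would leave a bead
  -- at `w′`, while raising `w′` would not.
  position-unique : ∀ {mu mu′ w w′} → OddCover mu w → OddCover mu′ w′ → mu ≡ mu′ → w ≡ w′
  position-unique {w = w} {w′} (oddCover _ _ la↭₁ mu↭₁) (oddCover _ _ {R} la↭₂ mu↭₂) refl with w ≟ w′
  ... | yes w≡w′ = w≡w′
  ... | no  w≢w′ with Q , R₁↭ , _ ← ∷-split (trans (↭-sym la↭₁) la↭₂) w≢w′
      with ∈-resp-↭ mu↭₂ (∈-resp-↭ (↭-sym mu↭₁) (there (∈-resp-↭ (↭-sym R₁↭) (here refl))))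
  ... | here w′≡ = ⊥-elim (1+n≢n (sym w′≡))
  ... | there i  = ⊥-elim (unique-∉ (Unique-resp-↭ la↭₂ (distinct (valid-beads m P h))) i)

  one⇒unique : One n L → ∃[ mu ] ((Covers la mu × IsOdd mu) × (∀ mu′ → Covers la mu′ → IsOdd mu′ → mu′ ≡ mu))
  one⇒unique (w , ou , only) =
    let mu , oc = oddUp⇒oddCover ou in
    mu , (OddCover.covers oc , OddCover.isOdd oc) , λ mu′ cov odd →
      let w′ , oc′ = position cov odd in cover-unique oc′ oc (only w′ (oddCover⇒oddUp oc′))

  two⇒twoOddCovers : Two n L → TwoOddCovers la
  two⇒twoOddCovers (w₁ , w₂ , w₁≢w₂ , ou₁ , ou₂ , only) =
    let mu₁ , oc₁ = oddUp⇒oddCover ou₁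
        mu₂ , oc₂ = oddUp⇒oddCover ou₂
    in mu₁ , mu₂ , (λ eq → w₁≢w₂ (position-unique oc₁ oc₂ eq)) ,
      (OddCover.covers oc₁ , OddCover.isOdd oc₁) , (OddCover.covers oc₂ , OddCover.isOdd oc₂) , λ mu′ cov odd →
        let w′ , oc′ = position cov odd in
        Sum.map (cover-unique oc′ oc₁) (cover-unique oc′ oc₂) (only w′ (oddCover⇒oddUp oc′))

  zero⇒none : Zero n L → ∀ mu → Covers la mu → ¬ IsOdd mu
  zero⇒none none mu cov odd = let w , oc = position cov odd in none w (oddCover⇒oddUp oc)

-- Existence is parity: the number of tableaux of `mu` is the sum over its predecessors, and an odd
-- sum has an odd term. Uniqueness is `pred-unique`, carried over to partitions.
unique-odd-predecessor : ∀ {n} mu → IsPartition mu → size mu ≡ suc n → IsOdd mu →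
  ∃[ la ] ((IsPartition la × Covers la mu × IsOdd la)
    × (∀ la′ → IsPartition la′ → Covers la′ mu → IsOdd la′ → la′ ≡ la))
unique-odd-predecessor {n} mu P e oddMu = predecessor (D-true 1 (F n) M (odd⇒F m P hm e oddMu))
  where
  m = suc (suc n)
  M = beads m (part mu)
  hm : length mu ≤ m
  hm = ≤-trans (length≤size (proj₂ P)) (≤-trans (≤-reflexive e) (n≤1+n _))
  length-bound : ∀ {la} → IsPartition la → size la ≡ n → length la < m
  length-bound (_ , pos) eq = s≤s (≤-trans (length≤size pos) (≤-trans (≤-reflexive eq) (n≤1+n _)))
  toPred : ∀ {la w R} → IsPartition la → size la ≡ n → IsOdd la → beads m (part la) ↭ w ∷ R → M ↭ suc w ∷ R → OddPred n M w
  toPred {la} Pl eq odd la↭ mu↭ = oddPred mu↭ (∈-resp-↭ la↭ (zero∈beads m la (length-bound Pl eq)))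
    (F-resp n la↭ (odd⇒F m Pl (<⇒≤ (length-bound Pl eq)) eq odd))
  predecessor : ∃[ w ] ∃[ R ] (M ↭ suc w ∷ R × ∃[ C ] (C ↭ w ∷ R × F n C ≡ true)) → _
  predecessor (w , R , mu↭ , C , C↭ , oddC) =
    let la , Pl , hl , la↭ = realize m C (≡-trans (↭-length C↭) (≡-trans (sym (↭-length mu↭)) (beads-length m (part mu)))) (F-unique n oddC)
        la↭′ = trans la↭ C↭
        cov = covers-beads m Pl P hl hm la↭′ mu↭
        eq = suc-injective (≡-trans (sym (proj₂ (proj₂ cov))) e)
        odd = F⇒odd m Pl hl eq (F-resp n (↭-sym la↭) oddC)
    in la , (Pl , cov , odd) , λ la′ Pl′ cov′ odd′ →
      let eq′ = suc-injective (≡-trans (sym (proj₂ (proj₂ cov′))) e)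
          hl′ = <⇒≤ (length-bound Pl′ eq′)
          w′ , R′ , la′↭ , mu↭′ = covers⇒beads m la′ mu hl′ hm cov′
          w′≡w = pred-unique n (odd⇒F m P hm e oddMu) (valid-index e (valid-beads m P hm))
                   (toPred Pl′ eq′ odd′ la′↭ mu↭′) (toPred Pl eq odd la↭′ mu↭)
      in beads-determines m Pl′ Pl hl′ hl (same-beads w′≡w la′↭ mu↭′ la↭′)
    where
    same-beads : ∀ {w′ R′ B B′} → w′ ≡ w → B′ ↭ w′ ∷ R′ → M ↭ suc w′ ∷ R′ → B ↭ w ∷ R → B′ ↭ B
    same-beads refl B′↭ M↭ B↭ = trans B′↭ (trans (prep _ (drop-∷ (trans (↭-sym M↭) mu↭))) (↭-sym B↭))

odd⇒2∣suc : ∀ n → n % 2 ≡ 1 → 2 ∣ suc n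
odd⇒2∣suc (suc zero)    _ = ∣-refl
odd⇒2∣suc (suc (suc n)) e = ∣m∣n⇒∣m+n ∣-refl (odd⇒2∣suc n e)

theorem3p3 : (∀ (n : ℕ) (la : List ℕ) → IsPartition la → size la ≡ n → IsOdd la →
    (n % 2 ≡ 0 →
    ∃[ mu ] ((Covers la mu × IsOdd mu) × (∀ mu′ → Covers la mu′ → IsOdd mu′ → mu′ ≡ mu)))
    × (n % 2 ≡ 1 → ∀ (v : ℕ) → (2 ^ v) ∣ suc n → ¬ ((2 ^ suc v) ∣ suc n) →
    ∃[ ka ] (IsCore (2 ^ v) la ka
    × (IsHook ka → TwoOddCovers la)
    × (¬ IsHook ka → ∀ mu → Covers la mu → ¬ IsOdd mu))))
    × (∀ (mu : List ℕ) → IsPartition mu → 0 < size mu → IsOdd mu →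
    ∃[ la ] ((IsPartition la × Covers la mu × IsOdd la)
    × (∀ la′ → IsPartition la′ → Covers la′ mu → IsOdd la′ → la′ ≡ la)))
theorem3p3 = covers , λ mu P size>0 →
    unique-odd-predecessor mu P (sym (suc-pred (size mu) {{>-nonZero size>0}}))
  where
  covers : ∀ n la → IsPartition la → size la ≡ n → IsOdd la → _
  covers n la P e odd =
    (λ even → one⇒unique (even-case n m P e ≤-refl (m%n≡0⇒n∣m n 2 even) F≡true)) ,
    (λ odd-n v 2^v∣ 2^sv∤ →
      let ka , isCore , two , zero′ = odd-case n m v P e ≤-refl (odd⇒2∣suc n odd-n) 2^v∣ 2^sv∤ F≡true in
      ka , isCore , two⇒twoOddCovers ∘ two , zero⇒none ∘ zero′)
    where
    -- One bead more than cells: every cover fits, and the partition itself has a bead at 0.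
    m = suc n
    open Bridge m P e ≤-refl
    F≡true : F n (beads m (part la)) ≡ true
    F≡true = odd⇒F m P (≤-trans (length≤size (proj₂ P)) (≤-trans (≤-reflexive e) (n≤1+n n))) e odd
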